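{- For each finite nonempty set $V$ let $\mathrm{MG}^{\bullet}_{or}[V]$ be the $\mathbb{K}$-vector space with basis the pairs $(g,v)$ where $g$ is an oriented multigraph on $V$ and $v\in V$ (and let $\mathrm{MG}^{\bullet}_{or}[\emptyset]=\{0\}$). For disjoint finite sets $V_1,V_2$, $*\notin V_1\sqcup V_2$, and basis elements $(g_1,v_1)\in \mathrm{MG}^{\bullet}_{or}[V_1\sqcup\{*\}]$, $(g_2,v_2)\in \mathrm{MG}^{\bullet}_{or}[V_2]$, define $(g_1,v_1)\circ_*(g_2,v_2)$ as the sum (with multiplicity) over all elements obtained as follows: take the disjoint union of $g_1$ and $g_2$; remove the vertex $*$, so that some edges have loose ends; connect each loose source end to $v_2$; connect each loose target end to any vertex of $V_2$ (each loose target end independently, and one sums over all choices); the new root is $v_1$ if $v_1\neq *$ and $v_2$ if $v_1=*$. Extend bilinearly. Then the species $\mathrm{MG}^{\bullet}_{or}$ endowed with this partial composition (with units the edgeless graph on $\{v\}$ pointed at $v$) is an operad.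
   Context: $\mathbb{K}$ is a field of characteristic $0$. A (linear) species $S$ is a functor from finite sets with bijections to $\mathbb{K}$-vector spaces, $V\mapsto S[V]$, $\sigma\mapsto S[\sigma]$. An operad is a species $O$ with $O[\emptyset]=\{0\}$, units $e(v)\in O[\{v\}]$ (natural in $v$), and bilinear maps $\circ_*:O[V_1\sqcup\{*\}]\times O[V_2]\to O[V_1\sqcup V_2]$ (partial compositions, for disjoint finite sets $V_1$, $V_2$ and $*\notin V_1\sqcup V_2$), natural with respect to bijections, such that (i) $(x\circ_{*_1}y)\circ_{*_2}z=(x\circ_{*_2}z)\circ_{*_1}y$ for $x\in O[V_1\sqcup\{*_1,*_2\}]$, $y\in O[V_2]$, $z\in O[V_3]$; (ii) $(x\circ_{*_1}y)\circ_{*_2}z=x\circ_{*_1}(y\circ_{*_2}z)$ for $x\in O[V_1\sqcup\{*_1\}]$, $y\in O[V_2\sqcup\{*_2\}]$, $z\in O[V_3]$; (iii) $x\circ_* e(v)=O[\sigma](x)$, where $\sigma$ sends $*$ to $v$ and is the identity elsewhere, and $e(*)\circ_* x=x$. A multigraph on $V$ is a finite multiset of unordered pairs $\{u,v\}$ of (possibly equal) elements of $V$, called edges; the two vertices of an edge are its two ends (a loop has two ends at the same vertex). An oriented multigraph is a multigraph in which each end of each edge is labelled either "source" or "target" (both ends of an edge may carry the same label); equivalently, a finite multiset of unordered pairs of elements of $V\times\{\mathtt{s},\mathtt{t}\}$. When an end is reconnected it keeps its label. -}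

module Defs where

open import Level using (Level; _⊔_) renaming (suc to lsuc; zero to lzero)
open import Algebra.Apartness.Bundles using (HeytingField; HeytingCommutativeRing)
open import Algebra.Bundles using (CommutativeRing; Ring)
import Algebra.Definitions.RawMonoid as RawMonoidDefinitions
open import Algebra.Module.Bundles using (LeftModule)
import Algebra.Module.Morphism.Construct.Composition as Composition
import Algebra.Module.Morphism.Construct.Identity as Identity
open import Algebra.Module.Morphism.Structures using (module LeftModuleMorphisms)
open import Data.Empty using (⊥)
open import Data.Fin.Base using (Fin)
open import Data.Fin.Properties using (+↔⊎; 0↔⊥; 1↔⊤)
open import Data.List.Base
  using (List; []; _∷_; _++_; map; foldr; cartesianProduct; cartesianProductWith; allFin)
open import Data.List.Properties using (map-id; map-cong; map-∘)
import Data.List.Relation.Binary.Permutation.Setoid as Permutation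
import Data.List.Relation.Binary.Permutation.Setoid.Properties as Permutationₚ
open import Data.Nat.Base using (ℕ; suc; _+_)
open import Data.Product.Base using (_×_; _,_; map₁)
open import Data.Product.Relation.Binary.Pointwise.NonDependent using (_×ₛ_)
open import Data.Sum.Base using (_⊎_; inj₁; inj₂)
open import Data.Sum.Function.Propositional using (_⊎-↔_)
open import Data.Unit.Base using (⊤; tt)
open import Function.Base using (id; _∘_)
open import Function.Bundles using (_↔_; Inverse; mk↔ₛ′)
open import Function.Construct.Composition using (_↔-∘_)
open import Function.Construct.Identity using (↔-id)
open import Function.Construct.Symmetry using (↔-sym)
open import Relation.Binary.Bundles using (Setoid)
open import Relation.Binary.PropositionalEquality
  using (_≡_; refl; sym; cong; cong₂; _≗_; setoid)
open import Relation.Nullary.Negation using (¬_)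

private
  variable
    c ℓ₁ ℓ₂ : Level

------------------------------------------------------------------------
-- Fields

-- A classical field is a Heyting field whose apartness is the negation of equality.

module _ (K : HeytingField c ℓ₁ ℓ₂) where

  fieldRing : Ring c ℓ₁
  fieldRing = CommutativeRing.ring
    (HeytingCommutativeRing.commutativeRing (HeytingField.heytingCommutativeRing K))

  CharacteristicZero : Set ℓ₁
  CharacteristicZero = ∀ n → ¬ (suc n · 1# ≈ 0#)
    where
    open Ring fieldRing using (_≈_; 0#; 1#; +-rawMonoid)
    open RawMonoidDefinitions +-rawMonoid using () renaming (_×_ to infixr 8 _·_)

------------------------------------------------------------------------
-- Finite sets and bijections

-- The enumeration is only a witness of finiteness: morphisms are arbitrary
-- bijections of the underlying sets.

record FinSet : Set₁ where
  field
    Carrier     : Set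
    size        : ℕ
    enumeration : Fin size ↔ Carrier

  elements : List Carrier
  elements = map (Inverse.to enumeration) (allFin size)

open FinSet using (elements) renaming (Carrier to ∣_∣)

infix 4 _≅_

_≅_ : FinSet → FinSet → Set
V ≅ W = ∣ V ∣ ↔ ∣ W ∣

infixl 6 _⊔ˢ_

_⊔ˢ_ : FinSet → FinSet → FinSet
V ⊔ˢ W = record
  { Carrier     = ∣ V ∣ ⊎ ∣ W ∣
  ; size        = FinSet.size V + FinSet.size W
  ; enumeration = (FinSet.enumeration V ⊎-↔ FinSet.enumeration W) ↔-∘ +↔⊎
  }

∅ : FinSet
∅ = record { Carrier = ⊥ ; size = 0 ; enumeration = 0↔⊥ }

⋆ : FinSet
⋆ = record { Carrier = ⊤ ; size = 1 ; enumeration = 1↔⊤ }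

IsSingleton : (V : FinSet) → ∣ V ∣ → Set
IsSingleton V v = ∀ w → w ≡ v

⊎-swapʳ : ∀ {A B C : Set} → ((A ⊎ B) ⊎ C) ↔ ((A ⊎ C) ⊎ B)
⊎-swapʳ = mk↔ₛ′ f f inv inv
  where
  f : ∀ {A B C : Set} → (A ⊎ B) ⊎ C → (A ⊎ C) ⊎ B
  f (inj₁ (inj₁ a)) = inj₁ (inj₁ a)
  f (inj₁ (inj₂ b)) = inj₂ b
  f (inj₂ c)        = inj₁ (inj₂ c)

  inv : ∀ {A B C : Set} (x : (A ⊎ B) ⊎ C) → f (f x) ≡ x
  inv (inj₁ (inj₁ a)) = refl
  inv (inj₁ (inj₂ b)) = refl
  inv (inj₂ c)        = refl

⊎-assocˡ : ∀ {A B C : Set} → (A ⊎ (B ⊎ C)) ↔ ((A ⊎ B) ⊎ C)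
⊎-assocˡ = mk↔ₛ′
  (λ { (inj₁ a) → inj₁ (inj₁ a) ; (inj₂ (inj₁ b)) → inj₁ (inj₂ b) ; (inj₂ (inj₂ c)) → inj₂ c })
  (λ { (inj₁ (inj₁ a)) → inj₁ a ; (inj₁ (inj₂ b)) → inj₂ (inj₁ b) ; (inj₂ c) → inj₂ (inj₂ c) })
  (λ { (inj₁ (inj₁ a)) → refl ; (inj₁ (inj₂ b)) → refl ; (inj₂ c) → refl })
  (λ { (inj₁ a) → refl ; (inj₂ (inj₁ b)) → refl ; (inj₂ (inj₂ c)) → refl })

⊥-⊎ : ∀ {A : Set} → (⊥ ⊎ A) ↔ A
⊥-⊎ = mk↔ₛ′ (λ { (inj₁ ()) ; (inj₂ a) → a }) inj₂ (λ _ → refl) (λ { (inj₁ ()) ; (inj₂ a) → refl })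

⊤↔singleton : ∀ V v → IsSingleton V v → ⋆ ≅ V
⊤↔singleton V v v-only = mk↔ₛ′ (λ _ → v) (λ _ → tt) (λ w → sym (v-only w)) (λ _ → refl)

∅⊔⋆-singleton : IsSingleton (∅ ⊔ˢ ⋆) (inj₂ tt)
∅⊔⋆-singleton (inj₁ ())
∅⊔⋆-singleton (inj₂ tt) = refl

------------------------------------------------------------------------
-- Species and operads

module _ (K : HeytingField c ℓ₁ ℓ₂) where

  private
    R = fieldRing K

  IsLinear : ∀ {m n ℓm ℓn : Level} (M : LeftModule R m ℓm) (N : LeftModule R n ℓn) →
             (LeftModule.Carrierᴹ M → LeftModule.Carrierᴹ N) → Set (c ⊔ m ⊔ ℓm ⊔ ℓn)
  IsLinear M N = LeftModuleMorphisms.IsLeftModuleHomomorphism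
    (LeftModule.rawLeftModule M) (LeftModule.rawLeftModule N)

  record Species (m ℓm : Level) : Set (lsuc lzero ⊔ c ⊔ ℓ₁ ⊔ lsuc (m ⊔ ℓm)) where
    field
      space : FinSet → LeftModule R m ℓm

    infix 4 _≈_

    ⟦_⟧ : FinSet → Set m
    ⟦ V ⟧ = LeftModule.Carrierᴹ (space V)

    _≈_ : ∀ {V} → ⟦ V ⟧ → ⟦ V ⟧ → Set ℓm
    _≈_ {V} = LeftModule._≈ᴹ_ (space V)

    field
      transport        : ∀ {V W} → V ≅ W → ⟦ V ⟧ → ⟦ W ⟧
      transport-linear : ∀ {V W} (σ : V ≅ W) → IsLinear (space V) (space W) (transport σ)
      transport-resp   : ∀ {V W} {σ τ : V ≅ W} → Inverse.to σ ≗ Inverse.to τ →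
                         (x : ⟦ V ⟧) → transport {W = W} σ x ≈ transport τ x
      transport-id     : ∀ {V} (x : ⟦ V ⟧) → transport (↔-id ∣ V ∣) x ≈ x
      transport-∘      : ∀ {U V W} (σ : U ≅ V) (τ : V ≅ W) (x : ⟦ U ⟧) →
                         transport {W = W} (τ ↔-∘ σ) x ≈ transport τ (transport {W = V} σ x)

  -- Disjoint unions are tagged unions, with V ⊔ {*} rendered as V ⊔ˢ ⋆.  Sets that are
  -- literally equal for internal disjoint unions are identified here by explicit
  -- bijections.  Naturality in the name of * is automatic, since * is always the point
  -- of ⋆.  A unit e(v) is indexed by a one-point set V together with its point v.

  module _ {m ℓm : Level} (O : Species m ℓm) where

    open Species O

    record IsOperad
      (e : ∀ V (v : ∣ V ∣) → IsSingleton V v → ⟦ V ⟧)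
      (_∘⋆_ : ∀ {V₁ V₂} → ⟦ V₁ ⊔ˢ ⋆ ⟧ → ⟦ V₂ ⟧ → ⟦ V₁ ⊔ˢ V₂ ⟧)
      : Set (lsuc lzero ⊔ c ⊔ m ⊔ ℓm) where
      field
        empty-zero   : (x : ⟦ ∅ ⟧) → x ≈ LeftModule.0ᴹ (space ∅)

        e-natural    : ∀ {V W} (σ : V ≅ W) v v-only w-only →
                       transport {V} σ (e V v v-only) ≈ e W (Inverse.to σ v) w-only

        ∘-linearˡ    : ∀ {V₁ V₂} (y : ⟦ V₂ ⟧) →
                       IsLinear (space (V₁ ⊔ˢ ⋆)) (space (V₁ ⊔ˢ V₂)) (_∘⋆ y)

        ∘-linearʳ    : ∀ {V₁ V₂} (x : ⟦ V₁ ⊔ˢ ⋆ ⟧) →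
                       IsLinear (space V₂) (space (V₁ ⊔ˢ V₂)) (x ∘⋆_)

        ∘-natural    : ∀ {V₁ V₂ W₁ W₂} (σ₁ : V₁ ≅ W₁) (σ₂ : V₂ ≅ W₂)
                       (x : ⟦ V₁ ⊔ˢ ⋆ ⟧) (y : ⟦ V₂ ⟧) →
                       transport {W = W₁ ⊔ˢ ⋆} (σ₁ ⊎-↔ ↔-id ⊤) x ∘⋆ transport {W = W₂} σ₂ y
                       ≈ transport (σ₁ ⊎-↔ σ₂) (x ∘⋆ y)

        -- *₁ is the outer and *₂ the inner copy of ⋆.
        ∘-parallel   : ∀ {V₁ V₂ V₃} (x : ⟦ V₁ ⊔ˢ ⋆ ⊔ˢ ⋆ ⟧) (y : ⟦ V₂ ⟧) (z : ⟦ V₃ ⟧) →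
                       transport {W = V₁ ⊔ˢ V₂ ⊔ˢ ⋆} ⊎-swapʳ (x ∘⋆ y) ∘⋆ z
                       ≈ transport ⊎-swapʳ
                           (transport {W = V₁ ⊔ˢ V₃ ⊔ˢ ⋆} ⊎-swapʳ
                             (transport {W = V₁ ⊔ˢ ⋆ ⊔ˢ ⋆} ⊎-swapʳ x ∘⋆ z) ∘⋆ y)

        ∘-sequential : ∀ {V₁ V₂ V₃} (x : ⟦ V₁ ⊔ˢ ⋆ ⟧) (y : ⟦ V₂ ⊔ˢ ⋆ ⟧) (z : ⟦ V₃ ⟧) →
                       transport {W = V₁ ⊔ˢ V₂ ⊔ˢ ⋆} ⊎-assocˡ (x ∘⋆ y) ∘⋆ z
                       ≈ transport ⊎-assocˡ (x ∘⋆ (y ∘⋆ z))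

        ∘-identityʳ  : ∀ {V W} (x : ⟦ V ⊔ˢ ⋆ ⟧) w w-only →
                       x ∘⋆ e W w w-only
                       ≈ transport (↔-id ∣ V ∣ ⊎-↔ ⊤↔singleton W w w-only) x

        ∘-identityˡ  : ∀ {V} (x : ⟦ V ⟧) →
                       transport ⊥-⊎ (e (∅ ⊔ˢ ⋆) (inj₂ tt) ∅⊔⋆-singleton ∘⋆ x) ≈ x

------------------------------------------------------------------------
-- The vector space with a given basis

-- The basis is a setoid B.  The space consists of formal linear combinations modulo the
-- vector space axioms and the equality of B, i.e. it is the free module on B.

module Free (K : HeytingField c ℓ₁ ℓ₂) {b ℓb : Level} (B : Setoid b ℓb) where

  private
    module R = Ring (fieldRing K)
    module B = Setoid B

  infix  8 ⊖_
  infixr 7 _⊙_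
  infixl 6 _⊕_
  infix  4 _≋_

  data Combination : Set (c ⊔ b) where
    gen : B.Carrier → Combination
    𝟎   : Combination
    _⊕_ : Combination → Combination → Combination
    ⊖_  : Combination → Combination
    _⊙_ : R.Carrier → Combination → Combination

  data _≋_ : Combination → Combination → Set (c ⊔ ℓ₁ ⊔ b ⊔ ℓb) where
    ≋-refl      : ∀ {x} → x ≋ x
    ≋-sym       : ∀ {x y} → x ≋ y → y ≋ x
    ≋-trans     : ∀ {x y z} → x ≋ y → y ≋ z → x ≋ z
    gen-cong    : ∀ {s t} → s B.≈ t → gen s ≋ gen t
    ⊕-cong      : ∀ {x x′ y y′} → x ≋ x′ → y ≋ y′ → x ⊕ y ≋ x′ ⊕ y′
    ⊕-assoc     : ∀ x y z → (x ⊕ y) ⊕ z ≋ x ⊕ (y ⊕ z)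
    ⊕-comm      : ∀ x y → x ⊕ y ≋ y ⊕ x
    ⊕-identityˡ : ∀ x → 𝟎 ⊕ x ≋ x
    ⊖-cong      : ∀ {x x′} → x ≋ x′ → ⊖ x ≋ ⊖ x′
    ⊖-inverseˡ  : ∀ x → ⊖ x ⊕ x ≋ 𝟎
    ⊙-cong      : ∀ {k k′ x x′} → k R.≈ k′ → x ≋ x′ → k ⊙ x ≋ k′ ⊙ x′
    ⊙-zeroˡ     : ∀ x → R.0# ⊙ x ≋ 𝟎
    ⊙-zeroʳ     : ∀ k → k ⊙ 𝟎 ≋ 𝟎
    ⊙-identity  : ∀ x → R.1# ⊙ x ≋ x
    ⊙-assoc     : ∀ k l x → (k R.* l) ⊙ x ≋ k ⊙ (l ⊙ x)
    ⊙-distribˡ  : ∀ k x y → k ⊙ (x ⊕ y) ≋ k ⊙ x ⊕ k ⊙ y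
    ⊙-distribʳ  : ∀ x k l → (k R.+ l) ⊙ x ≋ k ⊙ x ⊕ l ⊙ x

  freeModule : LeftModule (fieldRing K) (c ⊔ b) (c ⊔ ℓ₁ ⊔ b ⊔ ℓb)
  freeModule = record
    { Carrierᴹ = Combination ; _≈ᴹ_ = _≋_ ; _+ᴹ_ = _⊕_ ; _*ₗ_ = _⊙_ ; 0ᴹ = 𝟎 ; -ᴹ_ = ⊖_
    ; isLeftModule = record
      { isLeftSemimodule = record
        { +ᴹ-isCommutativeMonoid = record
          { isMonoid = record
            { isSemigroup = record
              { isMagma = record
                { isEquivalence = record { refl = ≋-refl ; sym = ≋-sym ; trans = ≋-trans }
                ; ∙-cong = ⊕-cong
                }
              ; assoc = ⊕-assoc
              }
            ; identity = ⊕-identityˡ , λ x → ≋-trans (⊕-comm x 𝟎) (⊕-identityˡ x)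
            }
          ; comm = ⊕-comm
          }
        ; isPreleftSemimodule = record
          { *ₗ-cong      = ⊙-cong
          ; *ₗ-zeroˡ     = ⊙-zeroˡ
          ; *ₗ-distribʳ  = ⊙-distribʳ
          ; *ₗ-identityˡ = ⊙-identity
          ; *ₗ-assoc     = ⊙-assoc
          ; *ₗ-zeroʳ     = ⊙-zeroʳ
          ; *ₗ-distribˡ  = ⊙-distribˡ
          }
        }
      ; -ᴹ‿cong    = ⊖-cong
      ; -ᴹ‿inverse = ⊖-inverseˡ , λ x → ≋-trans (⊕-comm x (⊖ x)) (⊖-inverseˡ x)
      }
    }

  sumOf : List B.Carrier → Combination
  sumOf = foldr (λ s x → gen s ⊕ x) 𝟎

  module _ {m ℓm : Level} (M : LeftModule (fieldRing K) m ℓm) where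

    open LeftModule M

    extend : (B.Carrier → Carrierᴹ) → Combination → Carrierᴹ
    extend f (gen s) = f s
    extend f 𝟎       = 0ᴹ
    extend f (x ⊕ y) = extend f x +ᴹ extend f y
    extend f (⊖ x)   = -ᴹ extend f x
    extend f (k ⊙ x) = k *ₗ extend f x

    extend-cong : ∀ {f} → (∀ {s t} → s B.≈ t → f s ≈ᴹ f t) →
                  ∀ {x y} → x ≋ y → extend f x ≈ᴹ extend f y
    extend-cong fc ≋-refl             = ≈ᴹ-refl
    extend-cong fc (≋-sym p)          = ≈ᴹ-sym (extend-cong fc p)
    extend-cong fc (≋-trans p q)      = ≈ᴹ-trans (extend-cong fc p) (extend-cong fc q)
    extend-cong fc (gen-cong p)       = fc p
    extend-cong fc (⊕-cong p q)       = +ᴹ-cong (extend-cong fc p) (extend-cong fc q)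
    extend-cong fc (⊕-assoc x y z)    = +ᴹ-assoc _ _ _
    extend-cong fc (⊕-comm x y)       = +ᴹ-comm _ _
    extend-cong fc (⊕-identityˡ x)    = +ᴹ-identityˡ _
    extend-cong fc (⊖-cong p)         = -ᴹ‿cong (extend-cong fc p)
    extend-cong fc (⊖-inverseˡ x)     = -ᴹ‿inverseˡ _
    extend-cong fc (⊙-cong p q)       = *ₗ-cong p (extend-cong fc q)
    extend-cong fc (⊙-zeroˡ x)        = *ₗ-zeroˡ _
    extend-cong fc (⊙-zeroʳ k)        = *ₗ-zeroʳ _
    extend-cong fc (⊙-identity x)     = *ₗ-identityˡ _
    extend-cong fc (⊙-assoc k l x)    = *ₗ-assoc _ _ _
    extend-cong fc (⊙-distribˡ k x y) = *ₗ-distribˡ _ _ _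
    extend-cong fc (⊙-distribʳ x k l) = *ₗ-distribʳ _ _ _

    extend-linear : ∀ {f} → (∀ {s t} → s B.≈ t → f s ≈ᴹ f t) →
                    IsLinear K freeModule M (extend f)
    extend-linear fc = record
      { +ᴹ-isGroupHomomorphism = record
        { isMonoidHomomorphism = record
          { isMagmaHomomorphism = record
            { isRelHomomorphism = record { cong = extend-cong fc }
            ; homo = λ _ _ → ≈ᴹ-refl
            }
          ; ε-homo = ≈ᴹ-refl
          }
        ; ⁻¹-homo = λ _ → ≈ᴹ-refl
        }
      ; *ₗ-homo = λ _ _ → ≈ᴹ-refl
      }

    linear-ext : ∀ {φ ψ} → IsLinear K freeModule M φ → IsLinear K freeModule M ψ →
                 (∀ s → φ (gen s) ≈ᴹ ψ (gen s)) → ∀ x → φ x ≈ᴹ ψ x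
    linear-ext {φ} {ψ} φ-lin ψ-lin eq = go
      where
      module φ = LeftModuleMorphisms.IsLeftModuleHomomorphism φ-lin
      module ψ = LeftModuleMorphisms.IsLeftModuleHomomorphism ψ-lin

      go : ∀ x → φ x ≈ᴹ ψ x
      go (gen s) = eq s
      go 𝟎       = ≈ᴹ-trans φ.0ᴹ-homo (≈ᴹ-sym ψ.0ᴹ-homo)
      go (x ⊕ y) =
        ≈ᴹ-trans (φ.+ᴹ-homo x y) (≈ᴹ-trans (+ᴹ-cong (go x) (go y)) (≈ᴹ-sym (ψ.+ᴹ-homo x y)))
      go (⊖ x)   = ≈ᴹ-trans (φ.-ᴹ-homo x) (≈ᴹ-trans (-ᴹ‿cong (go x)) (≈ᴹ-sym (ψ.-ᴹ-homo x)))
      go (k ⊙ x) =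
        ≈ᴹ-trans (φ.*ₗ-homo k x) (≈ᴹ-trans (*ₗ-cong R.refl (go x)) (≈ᴹ-sym (ψ.*ₗ-homo k x)))

------------------------------------------------------------------------
-- Oriented multigraphs

data Label : Set where
  source target : Label

End : Set → Set
End V = V × Label

Edge : Set → Set
Edge V = End V × End V

-- Edges are unordered pairs of ends.

data _~_ {V : Set} : Edge V → Edge V → Set where
  same    : ∀ {ε} → ε ~ ε
  flipped : ∀ {α β} → (α , β) ~ (β , α)

edgeSetoid : Set → Setoid lzero lzero
edgeSetoid V = record
  { Carrier       = Edge V
  ; _≈_           = _~_
  ; isEquivalence = record { refl = same ; sym = ~-sym ; trans = ~-trans }
  }
  where
  ~-sym : ∀ {ε η : Edge V} → ε ~ η → η ~ ε
  ~-sym same    = same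
  ~-sym flipped = flipped

  ~-trans : ∀ {ε η θ : Edge V} → ε ~ η → η ~ θ → ε ~ θ
  ~-trans same    q       = q
  ~-trans flipped same    = flipped
  ~-trans flipped flipped = same

-- Finite multisets of edges are lists of edges up to permutation.

OrMultigraph : Set → Set
OrMultigraph V = List (Edge V)

Pointed : Set → Set
Pointed V = OrMultigraph V × V

pointedSetoid : Set → Setoid lzero lzero
pointedSetoid V = Permutation.↭-setoid (edgeSetoid V) ×ₛ setoid V

mapEdge : ∀ {V W : Set} → (V → W) → Edge V → Edge W
mapEdge f (α , β) = map₁ f α , map₁ f β

relabel : ∀ {V W : Set} → (V → W) → Pointed V → Pointed W
relabel f (g , v) = map (mapEdge f) g , f v

relabel-cong : ∀ {V W : Set} (f : V → W) {p q : Pointed V} →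
               Setoid._≈_ (pointedSetoid V) p q →
               Setoid._≈_ (pointedSetoid W) (relabel f p) (relabel f q)
relabel-cong {V} {W} f (g↭h , v≡w) =
  Permutationₚ.map⁺ (edgeSetoid V) (edgeSetoid W) (λ { same → same ; flipped → flipped }) g↭h ,
  cong f v≡w

relabel-≗ : ∀ {V W : Set} {f f′ : V → W} → f ≗ f′ → relabel f ≗ relabel f′
relabel-≗ f≗f′ (g , v) = cong₂ _,_ (map-cong mapEdge-≗ g) (f≗f′ v)
  where
  mapEdge-≗ : mapEdge _ ≗ mapEdge _
  mapEdge-≗ ((u , _) , (w , _)) =
    cong₂ (λ u′ w′ → (u′ , _) , (w′ , _)) (f≗f′ u) (f≗f′ w)

------------------------------------------------------------------------
-- The species MG•or

module _ (K : HeytingField c ℓ₁ ℓ₂) where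

  private module F (V : FinSet) = Free K (pointedSetoid ∣ V ∣)

  MG•or : Species K c (c ⊔ ℓ₁)
  MG•or = record
    { space            = F.freeModule
    ; transport        = λ {V} {W} → transport V W
    ; transport-linear = λ {V} {W} → transport-linear V W
    ; transport-resp   = λ {V} {W} {σ} {τ} σ≗τ →
        F.linear-ext V (F.freeModule W) (transport-linear V W σ) (transport-linear V W τ)
          (gen-≡ W ∘ relabel-≗ σ≗τ)
    ; transport-id     = λ {V} →
        F.linear-ext V (F.freeModule V) (transport-linear V V (↔-id ∣ V ∣))
          (Identity.isLeftModuleHomomorphism _ Free.≋-refl)
          (λ (g , v) → gen-≡ V (cong (_, v) (map-id g)))
    ; transport-∘      = λ {U} {V} {W} σ τ →
        F.linear-ext U (F.freeModule W) (transport-linear U W (τ ↔-∘ σ))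
          (Composition.isLeftModuleHomomorphism Free.≋-trans
            (transport-linear U V σ) (transport-linear V W τ))
          (λ (g , v) → gen-≡ W (cong (_, _) (map-∘ g)))
    }
    where
    transport : ∀ V W → V ≅ W → F.Combination V → F.Combination W
    transport V W σ = F.extend V (F.freeModule W) (Free.gen ∘ relabel (Inverse.to σ))

    transport-linear : ∀ V W σ → IsLinear K (F.freeModule V) (F.freeModule W) (transport V W σ)
    transport-linear V W σ =
      F.extend-linear V (F.freeModule W) (Free.gen-cong ∘ relabel-cong (Inverse.to σ))

    gen-≡ : ∀ V {p q} → p ≡ q → F._≋_ V (Free.gen p) (Free.gen q)
    gen-≡ V refl = Free.≋-refl

  unit : ∀ V (v : ∣ V ∣) → IsSingleton V v → F.Combination V
  unit V v _ = Free.gen ([] , v)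

------------------------------------------------------------------------
-- Partial composition

-- The lists enumerate, with multiplicity, the possible outcomes of reconnecting the
-- loose ends left by the removal of * to V₂, where r is the root of the inserted graph.

module _ (V₁ V₂ : FinSet) (r : ∣ V₂ ∣) where

  reconnectEnd : End ∣ V₁ ⊔ˢ ⋆ ∣ → List (End ∣ V₁ ⊔ˢ V₂ ∣)
  reconnectEnd (inj₁ v  , l)      = (inj₁ v , l) ∷ []
  reconnectEnd (inj₂ tt , source) = (inj₂ r , source) ∷ []
  reconnectEnd (inj₂ tt , target) = map (λ w → inj₂ w , target) (elements V₂)

  reconnectEdge : Edge ∣ V₁ ⊔ˢ ⋆ ∣ → List (Edge ∣ V₁ ⊔ˢ V₂ ∣)
  reconnectEdge (α , β) = cartesianProduct (reconnectEnd α) (reconnectEnd β)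

  reconnect : OrMultigraph ∣ V₁ ⊔ˢ ⋆ ∣ → List (OrMultigraph ∣ V₁ ⊔ˢ V₂ ∣)
  reconnect []      = [] ∷ []
  reconnect (ε ∷ g) = cartesianProductWith _∷_ (reconnectEdge ε) (reconnect g)

  newRoot : ∣ V₁ ⊔ˢ ⋆ ∣ → ∣ V₁ ⊔ˢ V₂ ∣
  newRoot (inj₁ v)  = inj₁ v
  newRoot (inj₂ tt) = inj₂ r

insertions : ∀ V₁ V₂ → Pointed ∣ V₁ ⊔ˢ ⋆ ∣ → Pointed ∣ V₂ ∣ → List (Pointed ∣ V₁ ⊔ˢ V₂ ∣)
insertions V₁ V₂ (g₁ , v₁) (g₂ , v₂) =
  map (λ h → h ++ map (mapEdge inj₂) g₂ , newRoot V₁ V₂ v₂ v₁) (reconnect V₁ V₂ v₂ g₁)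

module _ (K : HeytingField c ℓ₁ ℓ₂) where

  private module F (V : FinSet) = Free K (pointedSetoid ∣ V ∣)

  compose : ∀ V₁ V₂ → F.Combination (V₁ ⊔ˢ ⋆) → F.Combination V₂ → F.Combination (V₁ ⊔ˢ V₂)
  compose V₁ V₂ x y =
    F.extend (V₁ ⊔ˢ ⋆) target-space
      (λ p → F.extend V₂ target-space (λ q → F.sumOf (V₁ ⊔ˢ V₂) (insertions V₁ V₂ p q)) y) x
    where target-space = F.freeModule (V₁ ⊔ˢ V₂)

-- All maps in the axioms are multilinear, so the axioms need only be checked on basis
-- elements.  There a partial composition is the sum over all graphs obtained by
-- substituting, independently at every end of every edge, a member of a list of ends
-- depending on that end only.  Such substitutions compose like Kleisli arrows of the list
-- monad, up to reordering the sum.  Each axiom therefore reduces to comparing what its two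
-- sides do to a single end.  In the sequential axiom, the main case is a loose target end:
-- its choices in V₂ ⊔ V₃ are those in V₂ together with those in V₃ reached through the
-- inner *.

module Submission where

open import Algebra.Apartness.Bundles using (HeytingField; HeytingCommutativeRing)
open import Algebra.Bundles using (CommutativeMonoid; Ring)
open import Algebra.Module.Bundles using (LeftModule)
import Algebra.Module.Morphism.Construct.Composition as Composition
import Algebra.Module.Morphism.Construct.Identity as Identity
open import Algebra.Module.Morphism.Structures using (module LeftModuleMorphisms)
import Algebra.Properties.CommutativeMonoid.Sum as VectorSum
import Algebra.Properties.CommutativeSemigroup as CommutativeSemigroupProperties
import Algebra.Properties.Group as GroupProperties
open import Data.Fin.Base using (Fin; zero; suc; splitAt)
open import Data.List.Base
  using (List; []; _∷_; [_]; _++_; map; foldr; tabulate; cartesianProduct;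
         cartesianProductWith)
open import Data.List.Properties
  using (map-++; map-∘; map-id; map-tabulate; ++-assoc; ++-identityʳ)
import Data.List.Relation.Binary.Permutation.Homogeneous as Homogeneous
import Data.List.Relation.Binary.Permutation.Setoid as Permutation
import Data.List.Relation.Binary.Permutation.Setoid.Properties as Permutationₚ
open import Data.List.Relation.Binary.Pointwise.Base using (Pointwise; []; _∷_)
open import Data.Nat.Base using (zero; suc)
open import Data.Product.Base using (_,_; proj₁; map₁)
open import Data.Sum.Base as Sum using (_⊎_; inj₁; inj₂)
open import Data.Sum.Function.Propositional using (_⊎-↔_)
open import Data.Unit.Base using (⊤; tt)
open import Function.Base using (_∘_; id)
open import Function.Bundles using (Inverse)
open import Function.Construct.Composition using (_↔-∘_)
open import Function.Construct.Identity using (↔-id)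
open import Function.Construct.Symmetry using (↔-sym)
open import Level using (Level)
open import Relation.Binary.Bundles using (Setoid)
open import Relation.Binary.PropositionalEquality as ≡ using (_≡_; refl; cong; cong₂)
import Relation.Binary.Reasoning.Setoid as SetoidReasoning
open import Defs

open Free using (gen)
open FinSet using (elements; size; enumeration) renaming (Carrier to ∣_∣)

-- The two sides of an axiom produce the same outcomes, but list them in different orders. Such
-- lists of graphs are never compared by permutations, only through their sums: two lists of ends
-- count as equal when `∑ xs k ≈ ∑ ys k` for every `k`. As `k` is arbitrary, it can absorb the
-- choices still to be made at other ends and edges, so a statement about one end passes to an edge
-- and then to a whole graph by choosing `k`. Reordering outcomes thus becomes interchanging finite
-- sums, which works in any commutative monoid.
--
-- A different reordering, that of the edges within a graph and of the ends within an edge, has to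
-- be dealt with when composition is shown to be well defined on multisets, and in the parallel
-- axiom, where the two inserted graphs are appended in opposite orders. In the other axioms the
-- edge lists of matching outcomes are literally equal.

private
  variable
    a b m ℓ : Level
    A B C : Set

-- Substituting lists of ends in a multigraph

substituteEdge : (End A → List (End B)) → Edge A → List (Edge B)
substituteEdge φ (α , β) = cartesianProduct (φ α) (φ β)

-- `reconnect` with its rule for ends made a parameter: composites of insertions and relabellings
-- stay within this form, although they are no longer given by `reconnectEnd`.
substitute : (End A → List (End B)) → OrMultigraph A → List (OrMultigraph B)
substitute φ []      = [ [] ]
substitute φ (ε ∷ g) = cartesianProductWith _∷_ (substituteEdge φ ε) (substitute φ g)

substitute-map : (f : A → B) (φ : End B → List (End C)) → ∀ g →
                 substitute φ (map (mapEdge f) g) ≡ substitute (φ ∘ map₁ f) g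
substitute-map f φ []      = refl
substitute-map f φ (ε ∷ g) =
  cong (cartesianProductWith _∷_ (substituteEdge φ (mapEdge f ε))) (substitute-map f φ g)

map-mapEdge-++ : (f : B → C) (i : A → B) → ∀ h g →
                 map (mapEdge f) (h ++ map (mapEdge i) g)
                 ≡ map (mapEdge f) h ++ map (mapEdge (f ∘ i)) g
map-mapEdge-++ f i h g =
  ≡.trans (map-++ (mapEdge f) h _) (cong (map (mapEdge f) h ++_) (≡.sym (map-∘ g)))

reconnect≡substitute : ∀ V₁ V₂ r g →
                       reconnect V₁ V₂ r g ≡ substitute (reconnectEnd V₁ V₂ r) g
reconnect≡substitute V₁ V₂ r []      = refl
reconnect≡substitute V₁ V₂ r (ε ∷ g) =
  cong (cartesianProductWith _∷_ (reconnectEdge V₁ V₂ r ε)) (reconnect≡substitute V₁ V₂ r g)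

-- Finite sums in a commutative monoid

module Summation (M : CommutativeMonoid m ℓ) where

  open CommutativeMonoid M renaming (refl to ≈-refl)
  open CommutativeSemigroupProperties commutativeSemigroup using (interchange)
  open SetoidReasoning setoid
  open VectorSum M using (sum; sum-permute; sum-cong-≋)

  ∑ : {X : Set a} → List X → (X → Carrier) → Carrier
  ∑ xs k = foldr (λ x s → k x ∙ s) ε xs

  syntax ∑ xs (λ x → s) = ∑[ x ∈ xs ] s

  ∑-cong : {X : Set a} {k k′ : X → Carrier} → ∀ xs → (∀ x → k x ≈ k′ x) → ∑ xs k ≈ ∑ xs k′
  ∑-cong []       eq = ≈-refl
  ∑-cong (x ∷ xs) eq = ∙-cong (eq x) (∑-cong xs eq)

  ∑-≡ : {X : Set a} {xs ys : List X} (k : X → Carrier) → xs ≡ ys → ∑ xs k ≈ ∑ ys k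
  ∑-≡ k p = reflexive (cong (λ xs → ∑ xs k) p)

  ∑-singleton : {X : Set a} (x : X) (k : X → Carrier) → ∑ [ x ] k ≈ k x
  ∑-singleton x k = identityʳ (k x)

  ∑-++ : {X : Set a} (xs ys : List X) (k : X → Carrier) → ∑ (xs ++ ys) k ≈ ∑ xs k ∙ ∑ ys k
  ∑-++ []       ys k = sym (identityˡ _)
  ∑-++ (x ∷ xs) ys k = trans (∙-congˡ (∑-++ xs ys k)) (sym (assoc _ _ _))

  ∑-map : {X : Set a} {Y : Set b} (f : X → Y) (xs : List X) (k : Y → Carrier) →
          ∑ (map f xs) k ≈ ∑ xs (k ∘ f)
  ∑-map f []       k = ≈-refl
  ∑-map f (x ∷ xs) k = ∙-congˡ (∑-map f xs k)

  ∑-ε : {X : Set a} (xs : List X) → ∑ xs (λ _ → ε) ≈ ε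
  ∑-ε []       = ≈-refl
  ∑-ε (x ∷ xs) = trans (identityˡ _) (∑-ε xs)

  ∑-∙ : {X : Set a} (xs : List X) (k k′ : X → Carrier) →
        ∑[ x ∈ xs ] (k x ∙ k′ x) ≈ ∑ xs k ∙ ∑ xs k′
  ∑-∙ []       k k′ = sym (identityˡ ε)
  ∑-∙ (x ∷ xs) k k′ = trans (∙-congˡ (∑-∙ xs k k′)) (interchange _ _ _ _)

  ∑-swap : {X : Set a} {Y : Set b} (xs : List X) (ys : List Y) (k : X → Y → Carrier) →
           ∑[ x ∈ xs ] ∑[ y ∈ ys ] k x y ≈ ∑[ y ∈ ys ] ∑[ x ∈ xs ] k x y
  ∑-swap []       ys k = sym (∑-ε ys)
  ∑-swap (x ∷ xs) ys k = trans (∙-congˡ (∑-swap xs ys k)) (sym (∑-∙ ys (k x) _))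

  ∑-cartesianProductWith :
    {X Y Z : Set} (f : X → Y → Z) (xs : List X) (ys : List Y) (k : Z → Carrier) →
    ∑ (cartesianProductWith f xs ys) k ≈ ∑[ x ∈ xs ] ∑[ y ∈ ys ] k (f x y)
  ∑-cartesianProductWith f []       ys k = ≈-refl
  ∑-cartesianProductWith f (x ∷ xs) ys k =
    trans (∑-++ (map (f x) ys) _ k)
      (∙-cong (∑-map (f x) ys k) (∑-cartesianProductWith f xs ys k))

  ∑-elements : ∀ V (k : ∣ V ∣ → Carrier) →
               ∑ (elements V) k ≈ sum (k ∘ Inverse.to (enumeration V))
  ∑-elements V k = begin
    ∑ (elements V) k                         ≡⟨ cong (λ vs → ∑ vs k) (map-tabulate id to) ⟩
    ∑ (tabulate to) k                        ≈⟨ ∑-tabulate to ⟩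
    sum (k ∘ to)                             ∎
    where
    to = Inverse.to (enumeration V)

    ∑-tabulate : ∀ {n} (f : Fin n → ∣ V ∣) → ∑ (tabulate f) k ≈ sum (k ∘ f)
    ∑-tabulate {zero}  f = ≈-refl
    ∑-tabulate {suc n} f = ∙-congˡ (∑-tabulate (f ∘ suc))

  -- The enumerations of `V` and `W` are unrelated to `σ`, and `elements W` need not be the image of
  -- `elements V` as a list. Conjugating `σ` by the enumerations gives a bijection of index sets,
  -- under which a finite sum is invariant.
  ∑-elements-≅ : ∀ {V W} (σ : V ≅ W) (k : ∣ W ∣ → Carrier) →
                 ∑ (elements W) k ≈ ∑ (elements V) (k ∘ Inverse.to σ)
  ∑-elements-≅ {V} {W} σ k = begin
    ∑ (elements W) k                   ≈⟨ ∑-elements W k ⟩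
    sum (k ∘ toW)                      ≈⟨ sum-permute (k ∘ toW) π ⟩
    sum (k ∘ toW ∘ Inverse.to π)
      ≈⟨ sum-cong-≋ {size V} (λ i → reflexive (cong k (Inverse.strictlyInverseˡ (enumeration W)
           (Inverse.to σ (toV i))))) ⟩
    sum (k ∘ Inverse.to σ ∘ toV)       ≈⟨ ∑-elements V (k ∘ Inverse.to σ) ⟨
    ∑ (elements V) (k ∘ Inverse.to σ)  ∎
    where
    toV = Inverse.to (enumeration V)
    toW = Inverse.to (enumeration W)
    π = (↔-sym (enumeration W)) ↔-∘ (σ ↔-∘ enumeration V)

  ∑-elements-⊔ : ∀ V W (k : ∣ V ⊔ˢ W ∣ → Carrier) →
                 ∑ (elements (V ⊔ˢ W)) k
                 ≈ ∑ (elements V) (k ∘ inj₁) ∙ ∑ (elements W) (k ∘ inj₂)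
  ∑-elements-⊔ V W k = begin
    ∑ (elements (V ⊔ˢ W)) k
      ≈⟨ ∑-elements (V ⊔ˢ W) k ⟩
    sum (k ∘ Inverse.to (enumeration (V ⊔ˢ W)))
      -- The enumeration of a disjoint union is by definition `splitAt` followed by the two
      -- enumerations.
      ≈⟨ sum-splitAt (size V) (k ∘ Inverse.to (enumeration V ⊎-↔ enumeration W)) ⟩
    sum (k ∘ inj₁ ∘ Inverse.to (enumeration V)) ∙ sum (k ∘ inj₂ ∘ Inverse.to (enumeration W))
      ≈⟨ ∙-cong (∑-elements V (k ∘ inj₁)) (∑-elements W (k ∘ inj₂)) ⟨
    ∑ (elements V) (k ∘ inj₁) ∙ ∑ (elements W) (k ∘ inj₂) ∎
    where
    sum-splitAt : ∀ m {n} (f : Fin m ⊎ Fin n → Carrier) →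
                  sum (f ∘ splitAt m) ≈ sum (f ∘ inj₁) ∙ sum (f ∘ inj₂)
    sum-splitAt zero    f = sym (identityˡ _)
    sum-splitAt (suc m) f = begin
      f (inj₁ zero) ∙ sum (λ i → f (splitAt (suc m) (suc i)))
        ≈⟨ ∙-congˡ (sum-splitAt m (f ∘ Sum.map₁ suc)) ⟩
      f (inj₁ zero) ∙ (sum (f ∘ inj₁ ∘ suc) ∙ sum (f ∘ inj₂))
        ≈⟨ assoc _ _ _ ⟨
      sum (f ∘ inj₁) ∙ sum (f ∘ inj₂) ∎

  -- Sums over the outcomes of a substitution

  ∑-substitute-∷ : (φ : End A → List (End B)) → ∀ ε g k →
                   ∑ (substitute φ (ε ∷ g)) k
                   ≈ ∑[ η ∈ substituteEdge φ ε ] ∑[ h ∈ substitute φ g ] k (η ∷ h)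
  ∑-substitute-∷ φ ε g k = ∑-cartesianProductWith _∷_ (substituteEdge φ ε) (substitute φ g) k

  -- The hypothesis asks for a single choice only after summation, because `φ α` need not be
  -- literally a one-element list: inserting a unit sums over `elements W` for an arbitrarily
  -- enumerated one-point set `W`.
  ∑-substitute-pure :
    {f : A → B} {φ : End A → List (End B)} → (∀ α k → ∑ (φ α) k ≈ k (map₁ f α)) →
    ∀ g k → ∑ (substitute φ g) k ≈ k (map (mapEdge f) g)
  ∑-substitute-pure         φ≈f []            k = identityʳ _
  ∑-substitute-pure {f = f} {φ} φ≈f ((α , β) ∷ g) k = begin
    ∑ (substitute φ ((α , β) ∷ g)) k
      ≈⟨ ∑-substitute-∷ φ (α , β) g k ⟩
    ∑[ η ∈ substituteEdge φ (α , β) ] ∑[ h ∈ substitute φ g ] k (η ∷ h)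
      ≈⟨ ∑-cong (substituteEdge φ (α , β)) (λ η → ∑-substitute-pure φ≈f g (k ∘ (η ∷_))) ⟩
    ∑[ η ∈ substituteEdge φ (α , β) ] k (η ∷ map (mapEdge f) g)
      ≈⟨ ∑-cartesianProductWith _,_ (φ α) (φ β) _ ⟩
    ∑[ α′ ∈ φ α ] ∑[ β′ ∈ φ β ] k ((α′ , β′) ∷ map (mapEdge f) g)
      ≈⟨ φ≈f α _ ⟩
    ∑[ β′ ∈ φ β ] k ((map₁ f α , β′) ∷ map (mapEdge f) g)
      ≈⟨ φ≈f β _ ⟩
    k (map (mapEdge f) ((α , β) ∷ g)) ∎

  ∑-substitute-++ : (φ : End A → List (End B)) → ∀ g g′ k →
                    ∑ (substitute φ (g ++ g′)) k
                    ≈ ∑[ h ∈ substitute φ g ] ∑[ h′ ∈ substitute φ g′ ] k (h ++ h′)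
  ∑-substitute-++ φ []      g′ k = sym (identityʳ _)
  ∑-substitute-++ φ (ε ∷ g) g′ k = begin
    ∑ (substitute φ (ε ∷ g ++ g′)) k
      ≈⟨ ∑-substitute-∷ φ ε (g ++ g′) k ⟩
    ∑[ η ∈ substituteEdge φ ε ] ∑[ h ∈ substitute φ (g ++ g′) ] k (η ∷ h)
      ≈⟨ ∑-cong (substituteEdge φ ε) (λ η → ∑-substitute-++ φ g g′ (k ∘ (η ∷_))) ⟩
    ∑[ η ∈ substituteEdge φ ε ] ∑[ h ∈ substitute φ g ] ∑[ h′ ∈ substitute φ g′ ] k (η ∷ h ++ h′)
      ≈⟨ ∑-substitute-∷ φ ε g _ ⟨
    ∑[ h ∈ substitute φ (ε ∷ g) ] ∑[ h′ ∈ substitute φ g′ ] k (h ++ h′) ∎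

  module _ {φ : End A → List (End B)} {ψ : End B → List (End C)} {χ : End A → List (End C)}
           (χ≈ψφ : ∀ α k → ∑ (χ α) k ≈ ∑[ β ∈ φ α ] ∑ (ψ β) k)
           where

    ∑-substituteEdge-∘ : ∀ ε k → ∑ (substituteEdge χ ε) k
                                 ≈ ∑[ η ∈ substituteEdge φ ε ] ∑ (substituteEdge ψ η) k
    ∑-substituteEdge-∘ (α , β) k = begin
      ∑ (substituteEdge χ (α , β)) k
        ≈⟨ ∑-cartesianProductWith _,_ (χ α) (χ β) k ⟩
      ∑[ α″ ∈ χ α ] ∑[ β″ ∈ χ β ] k (α″ , β″)
        ≈⟨ χ≈ψφ α _ ⟩
      ∑[ α′ ∈ φ α ] ∑[ α″ ∈ ψ α′ ] ∑[ β″ ∈ χ β ] k (α″ , β″)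
        ≈⟨ ∑-cong (φ α) (λ α′ → ∑-cong (ψ α′) (λ α″ → χ≈ψφ β _)) ⟩
      ∑[ α′ ∈ φ α ] ∑[ α″ ∈ ψ α′ ] ∑[ β′ ∈ φ β ] ∑[ β″ ∈ ψ β′ ] k (α″ , β″)
        -- Expanding `χ` finishes both stages at the first end before turning to the second, whereas
        -- composing substitutions performs the first stage at both ends before the second stage.
        -- The stages at different ends are independent, so the two middle sums commute.
        ≈⟨ ∑-cong (φ α) (λ α′ → ∑-swap (ψ α′) (φ β) _) ⟩
      ∑[ α′ ∈ φ α ] ∑[ β′ ∈ φ β ] ∑[ α″ ∈ ψ α′ ] ∑[ β″ ∈ ψ β′ ] k (α″ , β″)
        ≈⟨ ∑-cong (φ α) (λ α′ → ∑-cong (φ β) (λ β′ →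
             ∑-cartesianProductWith _,_ (ψ α′) (ψ β′) k)) ⟨
      ∑[ α′ ∈ φ α ] ∑[ β′ ∈ φ β ] ∑ (substituteEdge ψ (α′ , β′)) k
        ≈⟨ ∑-cartesianProductWith _,_ (φ α) (φ β) _ ⟨
      ∑[ η ∈ substituteEdge φ (α , β) ] ∑ (substituteEdge ψ η) k ∎

    ∑-substitute-∘ : ∀ g k → ∑[ h ∈ substitute φ g ] ∑ (substitute ψ h) k ≈ ∑ (substitute χ g) k
    ∑-substitute-∘ []      k = identityʳ _
    ∑-substitute-∘ (ε ∷ g) k = begin
      ∑[ h ∈ substitute φ (ε ∷ g) ] ∑ (substitute ψ h) k
        ≈⟨ ∑-substitute-∷ φ ε g _ ⟩
      ∑[ η ∈ substituteEdge φ ε ] ∑[ h ∈ substitute φ g ] ∑ (substitute ψ (η ∷ h)) k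
        ≈⟨ ∑-cong (substituteEdge φ ε) (λ η → ∑-cong (substitute φ g) (λ h →
             ∑-substitute-∷ ψ η h k)) ⟩
      ∑[ η ∈ substituteEdge φ ε ] ∑[ h ∈ substitute φ g ]
      ∑[ θ ∈ substituteEdge ψ η ] ∑[ h′ ∈ substitute ψ h ] k (θ ∷ h′)
        ≈⟨ ∑-cong (substituteEdge φ ε) (λ η → ∑-swap (substitute φ g) (substituteEdge ψ η) _) ⟩
      ∑[ η ∈ substituteEdge φ ε ] ∑[ θ ∈ substituteEdge ψ η ]
      ∑[ h ∈ substitute φ g ] ∑[ h′ ∈ substitute ψ h ] k (θ ∷ h′)
        ≈⟨ ∑-cong (substituteEdge φ ε) (λ η → ∑-cong (substituteEdge ψ η) (λ θ →
             ∑-substitute-∘ g (k ∘ (θ ∷_)))) ⟩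
      ∑[ η ∈ substituteEdge φ ε ] ∑[ θ ∈ substituteEdge ψ η ]
      ∑[ h′ ∈ substitute χ g ] k (θ ∷ h′)
        ≈⟨ ∑-substituteEdge-∘ ε _ ⟨
      ∑[ θ ∈ substituteEdge χ ε ] ∑[ h′ ∈ substitute χ g ] k (θ ∷ h′)
        ≈⟨ ∑-substitute-∷ χ ε g k ⟨
      ∑ (substitute χ (ε ∷ g)) k ∎

  -- Relabelling the outcomes is itself a substitution with a single choice at each end, so this is
  -- a case of composing substitutions.
  ∑-substitute-mapEdge :
    {φ : End A → List (End B)} {χ : End A → List (End C)} (f : B → C) →
    (∀ α k → ∑ (χ α) k ≈ ∑ (φ α) (k ∘ map₁ f)) →
    ∀ g k → ∑[ h ∈ substitute φ g ] k (map (mapEdge f) h) ≈ ∑ (substitute χ g) k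
  ∑-substitute-mapEdge {φ = φ} f χ≈φ g k = trans
    (∑-cong (substitute φ g) λ h → sym (∑-substitute-pure (λ β → ∑-singleton (map₁ f β)) h k))
    (∑-substitute-∘ {ψ = [_] ∘ map₁ f}
      (λ α k → trans (χ≈φ α k) (∑-cong (φ α) λ β → sym (∑-singleton (map₁ f β) k))) g k)

  module _ {B : Set} where

    open Permutation (edgeSetoid B) using (_↭_; ↭-refl; prep; swap)

    ∑-substituteEdge-~ : (φ : End A → List (End B)) → ∀ {ε η} → ε ~ η →
      (k : Edge B → Carrier) → (∀ {ε η} → ε ~ η → k ε ≈ k η) →
      ∑ (substituteEdge φ ε) k ≈ ∑ (substituteEdge φ η) k
    ∑-substituteEdge-~ φ same k resp = ≈-refl
    ∑-substituteEdge-~ φ (flipped {α} {β}) k resp = begin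
      ∑ (substituteEdge φ (α , β)) k           ≈⟨ ∑-cartesianProductWith _,_ (φ α) (φ β) k ⟩
      ∑[ α′ ∈ φ α ] ∑[ β′ ∈ φ β ] k (α′ , β′)  ≈⟨ ∑-swap (φ α) (φ β) _ ⟩
      ∑[ β′ ∈ φ β ] ∑[ α′ ∈ φ α ] k (α′ , β′)
        ≈⟨ ∑-cong (φ β) (λ β′ → ∑-cong (φ α) (λ α′ → resp flipped)) ⟩
      ∑[ β′ ∈ φ β ] ∑[ α′ ∈ φ α ] k (β′ , α′)  ≈⟨ ∑-cartesianProductWith _,_ (φ β) (φ α) k ⟨
      ∑ (substituteEdge φ (β , α)) k           ∎

    -- Makes composition well defined on multisets of edges. Permuting `g` permutes the edges of
    -- every outcome along with it, hence the condition that `k` respect `↭`.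
    ∑-substitute-↭ : (φ : End A → List (End B)) → ∀ {g g′} →
      Permutation._↭_ (edgeSetoid A) g g′ →
      (k : OrMultigraph B → Carrier) → (∀ {h h′} → h ↭ h′ → k h ≈ k h′) →
      ∑ (substitute φ g) k ≈ ∑ (substitute φ g′) k
    ∑-substitute-↭ {A} φ = go
      where
      ∷-cong : ∀ {ε ε′} g g′ → ε ~ ε′ →
        (∀ k → (∀ {h h′} → h ↭ h′ → k h ≈ k h′) →
          ∑ (substitute φ g) k ≈ ∑ (substitute φ g′) k) →
        ∀ k → (∀ {h h′} → h ↭ h′ → k h ≈ k h′) →
        ∑ (substitute φ (ε ∷ g)) k ≈ ∑ (substitute φ (ε′ ∷ g′)) k
      ∷-cong {ε} {ε′} g g′ ε~ε′ eq k resp = begin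
        ∑ (substitute φ (ε ∷ g)) k
          ≈⟨ ∑-substitute-∷ φ ε g k ⟩
        ∑[ η ∈ substituteEdge φ ε ] ∑[ h ∈ substitute φ g ] k (η ∷ h)
          ≈⟨ ∑-cong (substituteEdge φ ε) (λ η → eq (k ∘ (η ∷_)) (resp ∘ prep same)) ⟩
        ∑[ η ∈ substituteEdge φ ε ] ∑[ h ∈ substitute φ g′ ] k (η ∷ h)
          ≈⟨ ∑-substituteEdge-~ φ ε~ε′ _ (λ p → ∑-cong (substitute φ g′) λ h →
               resp (prep p ↭-refl)) ⟩
        ∑[ η ∈ substituteEdge φ ε′ ] ∑[ h ∈ substitute φ g′ ] k (η ∷ h)
          ≈⟨ ∑-substitute-∷ φ ε′ g′ k ⟨
        ∑ (substitute φ (ε′ ∷ g′)) k ∎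

      ∷-swap : ∀ ε ε′ g k → (∀ {h h′} → h ↭ h′ → k h ≈ k h′) →
        ∑ (substitute φ (ε ∷ ε′ ∷ g)) k ≈ ∑ (substitute φ (ε′ ∷ ε ∷ g)) k
      ∷-swap ε ε′ g k resp = begin
        ∑ (substitute φ (ε ∷ ε′ ∷ g)) k
          ≈⟨ expand ε ε′ k ⟩
        ∑[ η ∈ substituteEdge φ ε ] ∑[ η′ ∈ substituteEdge φ ε′ ]
        ∑[ h ∈ substitute φ g ] k (η ∷ η′ ∷ h)
          ≈⟨ ∑-swap (substituteEdge φ ε) (substituteEdge φ ε′) _ ⟩
        ∑[ η′ ∈ substituteEdge φ ε′ ] ∑[ η ∈ substituteEdge φ ε ]
        ∑[ h ∈ substitute φ g ] k (η ∷ η′ ∷ h)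
          ≈⟨ ∑-cong (substituteEdge φ ε′) (λ η′ → ∑-cong (substituteEdge φ ε) (λ η →
             ∑-cong (substitute φ g) (λ h → resp (swap same same ↭-refl)))) ⟩
        ∑[ η′ ∈ substituteEdge φ ε′ ] ∑[ η ∈ substituteEdge φ ε ]
        ∑[ h ∈ substitute φ g ] k (η′ ∷ η ∷ h)
          ≈⟨ expand ε′ ε k ⟨
        ∑ (substitute φ (ε′ ∷ ε ∷ g)) k ∎
        where
        expand : ∀ ε ε′ k → ∑ (substitute φ (ε ∷ ε′ ∷ g)) k
                 ≈ ∑[ η ∈ substituteEdge φ ε ] ∑[ η′ ∈ substituteEdge φ ε′ ]
                   ∑[ h ∈ substitute φ g ] k (η ∷ η′ ∷ h)
        expand ε ε′ k = trans (∑-substitute-∷ φ ε (ε′ ∷ g) k)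
          (∑-cong (substituteEdge φ ε) λ η → ∑-substitute-∷ φ ε′ g (k ∘ (η ∷_)))

      go : ∀ {g g′} → Permutation._↭_ (edgeSetoid A) g g′ → ∀ k →
           (∀ {h h′} → h ↭ h′ → k h ≈ k h′) →
           ∑ (substitute φ g) k ≈ ∑ (substitute φ g′) k
      go (Homogeneous.refl ps) = pointwise ps
        where
        pointwise : ∀ {g g′} → Pointwise _~_ g g′ → ∀ k →
                    (∀ {h h′} → h ↭ h′ → k h ≈ k h′) →
                    ∑ (substitute φ g) k ≈ ∑ (substitute φ g′) k
        pointwise []                     k resp = ≈-refl
        pointwise (_∷_ {xs = g} {g′} p ps) k resp = ∷-cong g g′ p (pointwise ps) k resp
      go (Homogeneous.prep {xs} {ys} p q) k resp = ∷-cong xs ys p (go q) k resp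
      -- This constructor also replaces both edges by equivalent ones. The replacement is made in
      -- place, and only then are the new edges exchanged.
      go (Homogeneous.swap {xs} {ys} {x} {y} {x′} {y′} p p′ q) k resp = trans
        (∷-cong (y ∷ xs) (y′ ∷ ys) p (∷-cong xs ys p′ (go q)) k resp) (∷-swap x′ y′ ys k resp)
      go (Homogeneous.trans {xs} {ys} {zs} p q) k resp =
        trans (go {xs} {ys} p k resp) (go {ys} {zs} q k resp)

  ∑-substitute-relabel-++ :
    (φ : End B → List (End C)) (f : A → B) {A′ : Set} (i : A′ → A) → ∀ h g k →
    ∑ (substitute φ (map (mapEdge f) (h ++ map (mapEdge i) g))) k
    ≈ ∑[ h′ ∈ substitute (φ ∘ map₁ f) h ] ∑[ g′ ∈ substitute (φ ∘ map₁ f ∘ map₁ i) g ] k (h′ ++ g′)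
  ∑-substitute-relabel-++ φ f i h g k = begin
    ∑ (substitute φ (map (mapEdge f) (h ++ map (mapEdge i) g))) k
      ≈⟨ ∑-≡ k (substitute-map f φ (h ++ map (mapEdge i) g)) ⟩
    ∑ (substitute (φ ∘ map₁ f) (h ++ map (mapEdge i) g)) k
      ≈⟨ ∑-substitute-++ (φ ∘ map₁ f) h (map (mapEdge i) g) k ⟩
    ∑[ h′ ∈ substitute (φ ∘ map₁ f) h ]
    ∑[ g′ ∈ substitute (φ ∘ map₁ f) (map (mapEdge i) g) ] k (h′ ++ g′)
      ≈⟨ ∑-cong (substitute (φ ∘ map₁ f) h) (λ h′ → ∑-≡ _ (substitute-map i (φ ∘ map₁ f) g)) ⟩
    ∑[ h′ ∈ substitute (φ ∘ map₁ f) h ] ∑[ g′ ∈ substitute (φ ∘ map₁ f ∘ map₁ i) g ] k (h′ ++ g′) ∎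

-- Linear maps and linearity of extensions

module Grafting {c ℓ₁ ℓ₂} (K : HeytingField c ℓ₁ ℓ₂) where

  private
    R = fieldRing K
    module R = Ring R

  -- `fieldRing` forgets commutativity, which is what makes a scalar multiple of a linear map
  -- linear.
  *-comm : ∀ k l → k R.* l R.≈ l R.* k
  *-comm = HeytingCommutativeRing.*-comm (HeytingField.heytingCommutativeRing K)

  module LinearMaps {m n ℓm ℓn} (M : LeftModule R m ℓm) (N : LeftModule R n ℓn) where

    private
      module M = LeftModule M
      module N = LeftModule N
    open LeftModuleMorphisms.IsLeftModuleHomomorphism
    open GroupProperties N.+ᴹ-group using (identityˡ-unique; inverseˡ-unique)
    open CommutativeSemigroupProperties
      (CommutativeMonoid.commutativeSemigroup N.+ᴹ-commutativeMonoid) using (interchange)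

    -- Preservation of zero and of negatives follows from additivity by cancellation in the group
    -- `N`.
    linear : ∀ {φ} → (∀ {x y} → x M.≈ᴹ y → φ x N.≈ᴹ φ y) →
             (∀ x y → φ (x M.+ᴹ y) N.≈ᴹ φ x N.+ᴹ φ y) →
             (∀ k x → φ (k M.*ₗ x) N.≈ᴹ k N.*ₗ φ x) → IsLinear K M N φ
    linear {φ} φ-cong φ-+ φ-* = record
      { +ᴹ-isGroupHomomorphism = record
        { isMonoidHomomorphism = record
          { isMagmaHomomorphism = record
            { isRelHomomorphism = record { cong = φ-cong }
            ; homo = φ-+
            }
          ; ε-homo = φ-0
          }
        ; ⁻¹-homo = λ x → inverseˡ-unique (φ (M.-ᴹ x)) (φ x)
            (N.≈ᴹ-trans (N.≈ᴹ-sym (φ-+ (M.-ᴹ x) x)) (N.≈ᴹ-trans (φ-cong (M.-ᴹ‿inverseˡ x)) φ-0))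
        }
      ; *ₗ-homo = φ-*
      }
      where
      φ-0 : φ M.0ᴹ N.≈ᴹ N.0ᴹ
      φ-0 = identityˡ-unique (φ M.0ᴹ) (φ M.0ᴹ)
        (N.≈ᴹ-trans (N.≈ᴹ-sym (φ-+ M.0ᴹ M.0ᴹ)) (φ-cong (M.+ᴹ-identityˡ M.0ᴹ)))

    +-linear : ∀ {φ ψ} → IsLinear K M N φ → IsLinear K M N ψ →
               IsLinear K M N (λ x → φ x N.+ᴹ ψ x)
    +-linear {φ} {ψ} φ-lin ψ-lin = linear
      (λ p → N.+ᴹ-cong (⟦⟧-cong φ-lin p) (⟦⟧-cong ψ-lin p))
      (λ x y → N.≈ᴹ-trans (N.+ᴹ-cong (+ᴹ-homo φ-lin x y) (+ᴹ-homo ψ-lin x y))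
                 (interchange (φ x) (φ y) (ψ x) (ψ y)))
      (λ k x → N.≈ᴹ-trans (N.+ᴹ-cong (*ₗ-homo φ-lin k x) (*ₗ-homo ψ-lin k x))
                 (N.≈ᴹ-sym (N.*ₗ-distribˡ k (φ x) (ψ x))))

    *-linear : ∀ {φ} k → IsLinear K M N φ → IsLinear K M N (λ x → k N.*ₗ φ x)
    *-linear {φ} k φ-lin = linear
      (λ p → N.*ₗ-cong R.refl (⟦⟧-cong φ-lin p))
      (λ x y → N.≈ᴹ-trans (N.*ₗ-cong R.refl (+ᴹ-homo φ-lin x y)) (N.*ₗ-distribˡ k (φ x) (φ y)))
      (λ l x → N.≈ᴹ-trans (N.*ₗ-cong R.refl (*ₗ-homo φ-lin l x))
        (N.≈ᴹ-trans (N.≈ᴹ-sym (N.*ₗ-assoc k l (φ x)))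
          (N.≈ᴹ-trans (N.*ₗ-cong (*-comm k l) N.≈ᴹ-refl) (N.*ₗ-assoc l k (φ x)))))

    0-linear : IsLinear K M N (λ _ → N.0ᴹ)
    0-linear = linear (λ _ → N.≈ᴹ-refl) (λ _ _ → N.≈ᴹ-sym (N.+ᴹ-identityˡ N.0ᴹ))
      (λ k _ → N.≈ᴹ-sym (N.*ₗ-zeroʳ k))

    ∑-linear : ∀ {φ} → IsLinear K M N φ → {X : Set a} (xs : List X) (k : X → M.Carrierᴹ) →
               φ (Summation.∑ M.+ᴹ-commutativeMonoid xs k) N.≈ᴹ
               Summation.∑ N.+ᴹ-commutativeMonoid xs (φ ∘ k)
    ∑-linear φ-lin []       k = 0ᴹ-homo φ-lin
    ∑-linear φ-lin (x ∷ xs) k = N.≈ᴹ-trans (+ᴹ-homo φ-lin (k x) _)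
      (N.+ᴹ-cong N.≈ᴹ-refl (∑-linear φ-lin xs k))

  module _ {b ℓb m n ℓm ℓn} (S : Setoid b ℓb) (M : LeftModule R m ℓm) (N : LeftModule R n ℓn) where

    private
      module S = Setoid S
      module M = LeftModule M
      module N = LeftModule N
      module F = Free K S
    open LeftModuleMorphisms.IsLeftModuleHomomorphism
    open LinearMaps F.freeModule N using (+-linear; *-linear)

    -- `extend` recurses on `x`, so linearity in `y` is not visible directly. For fixed `y` and
    -- `y′`, however, both sides of each linearity equation are linear in `x`, and on generators the
    -- equation is the linearity of `f s`.
    extend-linearʳ : {f : S.Carrier → M.Carrierᴹ → N.Carrierᴹ} →
                     (∀ {s t} y → s S.≈ t → f s y N.≈ᴹ f t y) → (∀ s → IsLinear K M N (f s)) →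
                     ∀ x → IsLinear K M N (λ y → F.extend N (λ s → f s y) x)
    extend-linearʳ {f} f-cong f-lin x = LinearMaps.linear M N
      (λ {y} {y′} y≈y′ → F.linear-ext N (ext y) (ext y′) (λ s → ⟦⟧-cong (f-lin s) y≈y′) x)
      (λ y y′ → F.linear-ext N (ext (y M.+ᴹ y′)) (+-linear (ext y) (ext y′))
        (λ s → +ᴹ-homo (f-lin s) y y′) x)
      (λ k y → F.linear-ext N (ext (k M.*ₗ y)) (*-linear k (ext y))
        (λ s → *ₗ-homo (f-lin s) k y) x)
      where
      ext : ∀ y → IsLinear K F.freeModule N (F.extend N (λ s → f s y))
      ext y = F.extend-linear N (f-cong y)

  private
    module F (V : FinSet) = Free K (pointedSetoid ∣ V ∣)
    module ΣV (V : FinSet) = Summation (LeftModule.+ᴹ-commutativeMonoid (F.freeModule V))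
  open Species (MG•or K) using (space; ⟦_⟧; transport; transport-linear)

  infix 4 _⊢_≈_

  _⊢_≈_ : ∀ V → ⟦ V ⟧ → ⟦ V ⟧ → Set _
  V ⊢ x ≈ y = F._≋_ V x y

  gen-≡ : ∀ V {p q} → p ≡ q → V ⊢ gen p ≈ gen q
  gen-≡ V refl = Free.≋-refl

  ∘-linear : ∀ {U V W φ ψ} → IsLinear K (space V) (space W) ψ →
             IsLinear K (space U) (space V) φ → IsLinear K (space U) (space W) (ψ ∘ φ)
  ∘-linear ψ-lin φ-lin = Composition.isLeftModuleHomomorphism Free.≋-trans φ-lin ψ-lin

  id-linear : ∀ V → IsLinear K (space V) (space V) id
  id-linear V = Identity.isLeftModuleHomomorphism _ Free.≋-refl

  -- Partial composition on basis elements and its bilinearity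

  module _ (V₁ V₂ : FinSet) where

    private
      V = V₁ ⊔ˢ V₂
      open Setoid (pointedSetoid ∣ V₁ ⊔ˢ ⋆ ∣) using () renaming (_≈_ to _≈₁_)
      open Setoid (pointedSetoid ∣ V₂ ∣) using () renaming (_≈_ to _≈₂_)
      module ↭ = Permutationₚ (edgeSetoid ∣ V ∣)

    graft : Pointed ∣ V₁ ⊔ˢ ⋆ ∣ → Pointed ∣ V₂ ∣ → ⟦ V ⟧
    graft p q = F.sumOf V (insertions V₁ V₂ p q)

    -- Stated under a linear map `φ` because in the axioms a composite is usually fed into a
    -- transport or into another composition, which has to be moved inside the sum.
    linear-graft : ∀ W {φ} → IsLinear K (space V) (space W) φ → ∀ g₁ v₁ g₂ v₂ →
      let open ΣV W in
      W ⊢ φ (graft (g₁ , v₁) (g₂ , v₂))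
        ≈ ∑[ h ∈ substitute (reconnectEnd V₁ V₂ v₂) g₁ ]
          φ (gen (h ++ map (mapEdge inj₂) g₂ , newRoot V₁ V₂ v₂ v₁))
    linear-graft W {φ} φ-lin g₁ v₁ g₂ v₂ = begin
      φ (graft (g₁ , v₁) (g₂ , v₂))
        ≈⟨ LinearMaps.∑-linear (space V) (space W) φ-lin
             (insertions V₁ V₂ (g₁ , v₁) (g₂ , v₂)) gen ⟩
      ∑ (insertions V₁ V₂ (g₁ , v₁) (g₂ , v₂)) (φ ∘ gen)
        ≈⟨ ∑-map _ (reconnect V₁ V₂ v₂ g₁) (φ ∘ gen) ⟩
      ∑[ h ∈ reconnect V₁ V₂ v₂ g₁ ]
      φ (gen (h ++ map (mapEdge inj₂) g₂ , newRoot V₁ V₂ v₂ v₁))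
        ≈⟨ ∑-≡ _ (reconnect≡substitute V₁ V₂ v₂ g₁) ⟩
      ∑[ h ∈ substitute (reconnectEnd V₁ V₂ v₂) g₁ ]
      φ (gen (h ++ map (mapEdge inj₂) g₂ , newRoot V₁ V₂ v₂ v₁)) ∎
      where
      open ΣV W
      open SetoidReasoning (LeftModule.≈ᴹ-setoid (space W))

    open ΣV V

    graft-∑ : ∀ g₁ v₁ g₂ v₂ →
      V ⊢ graft (g₁ , v₁) (g₂ , v₂)
        ≈ ∑[ h ∈ substitute (reconnectEnd V₁ V₂ v₂) g₁ ]
          gen (h ++ map (mapEdge inj₂) g₂ , newRoot V₁ V₂ v₂ v₁)
    graft-∑ = linear-graft V (id-linear V)

    graft-congˡ : ∀ {p p′} q → p ≈₁ p′ → V ⊢ graft p q ≈ graft p′ q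
    graft-congˡ {g₁ , v₁} {g₁′ , _} (g₂ , v₂) (g₁↭g₁′ , refl) = begin
      graft (g₁ , v₁) (g₂ , v₂)
        ≈⟨ graft-∑ g₁ v₁ g₂ v₂ ⟩
      ∑[ h ∈ substitute (reconnectEnd V₁ V₂ v₂) g₁ ]
      gen (h ++ map (mapEdge inj₂) g₂ , newRoot V₁ V₂ v₂ v₁)
        ≈⟨ ∑-substitute-↭ (reconnectEnd V₁ V₂ v₂) g₁↭g₁′ _
             (λ h↭h′ → Free.gen-cong (↭.++⁺ʳ (map (mapEdge inj₂) g₂) h↭h′ , refl)) ⟩
      ∑[ h ∈ substitute (reconnectEnd V₁ V₂ v₂) g₁′ ]
      gen (h ++ map (mapEdge inj₂) g₂ , newRoot V₁ V₂ v₂ v₁)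
        ≈⟨ graft-∑ g₁′ v₁ g₂ v₂ ⟨
      graft (g₁′ , v₁) (g₂ , v₂) ∎
      where open SetoidReasoning (LeftModule.≈ᴹ-setoid (space V))

    graft-congʳ : ∀ p {q q′} → q ≈₂ q′ → V ⊢ graft p q ≈ graft p q′
    graft-congʳ (g₁ , v₁) {g₂ , v₂} {g₂′ , _} (g₂↭g₂′ , refl) = begin
      graft (g₁ , v₁) (g₂ , v₂)
        ≈⟨ graft-∑ g₁ v₁ g₂ v₂ ⟩
      ∑[ h ∈ substitute (reconnectEnd V₁ V₂ v₂) g₁ ]
      gen (h ++ map (mapEdge inj₂) g₂ , newRoot V₁ V₂ v₂ v₁)
        ≈⟨ ∑-cong (substitute (reconnectEnd V₁ V₂ v₂) g₁) (λ h → Free.gen-cong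
             (↭.++⁺ˡ h (proj₁ (relabel-cong inj₂ {g₂ , v₂} {g₂′ , v₂} (g₂↭g₂′ , refl))) , refl)) ⟩
      ∑[ h ∈ substitute (reconnectEnd V₁ V₂ v₂) g₁ ]
      gen (h ++ map (mapEdge inj₂) g₂′ , newRoot V₁ V₂ v₂ v₁)
        ≈⟨ graft-∑ g₁ v₁ g₂′ v₂ ⟨
      graft (g₁ , v₁) (g₂′ , v₂) ∎
      where open SetoidReasoning (LeftModule.≈ᴹ-setoid (space V))

    extend-graft-congˡ : ∀ {p p′} y → p ≈₁ p′ →
      V ⊢ F.extend V₂ (space V) (graft p) y ≈ F.extend V₂ (space V) (graft p′) y
    extend-graft-congˡ {p} {p′} y p≈p′ = F.linear-ext V₂ (space V)
      (F.extend-linear V₂ (space V) (graft-congʳ p))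
      (F.extend-linear V₂ (space V) (graft-congʳ p′))
      (λ q → graft-congˡ q p≈p′) y

    compose-linearˡ : ∀ y → IsLinear K (space (V₁ ⊔ˢ ⋆)) (space V) (λ x → compose K V₁ V₂ x y)
    compose-linearˡ y = F.extend-linear (V₁ ⊔ˢ ⋆) (space V) (extend-graft-congˡ y)

    compose-linearʳ : ∀ x → IsLinear K (space V₂) (space V) (compose K V₁ V₂ x)
    compose-linearʳ = extend-linearʳ (pointedSetoid ∣ V₁ ⊔ˢ ⋆ ∣) (space V₂) (space V)
      extend-graft-congˡ (λ p → F.extend-linear V₂ (space V) (graft-congʳ p))

  -- Two successive insertions

  module _ {V₁ V₂ U V₃ : FinSet} (σ : V₁ ⊔ˢ V₂ ≅ U ⊔ˢ ⋆) where

    private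
      W = U ⊔ˢ V₃
      f = Inverse.to σ
    open ΣV W
    open SetoidReasoning (LeftModule.≈ᴹ-setoid (space W))

    -- The left sides of the parallel and the sequential axiom both have this shape, `σ` bringing
    -- the remaining copy of `⋆` to the outside. Edges of `g₁` undergo both insertions, merged here
    -- into `χ`; edges of `g₂` meet only the second, and edges of `g₃` neither.
    compose-transport-graft :
      ∀ {χ : End ∣ V₁ ⊔ˢ ⋆ ∣ → List (End ∣ W ∣)} g₁ v₁ g₂ v₂ g₃ v₃ →
      let ρ = reconnectEnd U V₃ v₃ ∘ map₁ f in
      (∀ α k → W ⊢ ∑ (χ α) k ≈ ∑[ β ∈ reconnectEnd V₁ V₂ v₂ α ] ∑ (ρ β) k) →
      W ⊢ compose K U V₃
            (transport {V₁ ⊔ˢ V₂} {U ⊔ˢ ⋆} σ (graft V₁ V₂ (g₁ , v₁) (g₂ , v₂))) (gen (g₃ , v₃))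
        ≈ ∑[ h ∈ substitute χ g₁ ] ∑[ g ∈ substitute (ρ ∘ map₁ inj₂) g₂ ]
          gen ((h ++ g) ++ map (mapEdge inj₂) g₃ , newRoot U V₃ v₃ (f (newRoot V₁ V₂ v₂ v₁)))
    compose-transport-graft {χ} g₁ v₁ g₂ v₂ g₃ v₃ χ≈ρ = begin
      compose K U V₃
        (transport {V₁ ⊔ˢ V₂} {U ⊔ˢ ⋆} σ (graft V₁ V₂ (g₁ , v₁) (g₂ , v₂))) (gen (g₃ , v₃))
        ≈⟨ linear-graft V₁ V₂ W
             (∘-linear {V₁ ⊔ˢ V₂} {U ⊔ˢ ⋆} {W}
               (compose-linearˡ U V₃ (gen (g₃ , v₃)))
               (transport-linear {V₁ ⊔ˢ V₂} {U ⊔ˢ ⋆} σ)) g₁ v₁ g₂ v₂ ⟩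
      ∑[ h ∈ substitute (reconnectEnd V₁ V₂ v₂) g₁ ]
      graft U V₃ (relabel f (h ++ map (mapEdge inj₂) g₂ , newRoot V₁ V₂ v₂ v₁)) (g₃ , v₃)
        ≈⟨ ∑-cong (substitute (reconnectEnd V₁ V₂ v₂) g₁) (λ h → begin
             graft U V₃ (relabel f (h ++ map (mapEdge inj₂) g₂ , newRoot V₁ V₂ v₂ v₁)) (g₃ , v₃)
               ≈⟨ graft-∑ U V₃ (map (mapEdge f) (h ++ map (mapEdge inj₂) g₂)) root g₃ v₃ ⟩
             ∑ (substitute (reconnectEnd U V₃ v₃)
                 (map (mapEdge f) (h ++ map (mapEdge inj₂) g₂))) result
               ≈⟨ ∑-substitute-relabel-++ (reconnectEnd U V₃ v₃) f inj₂ h g₂ result ⟩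
             ∑[ h′ ∈ substitute ρ h ] ∑[ g ∈ substitute (ρ ∘ map₁ inj₂) g₂ ] result (h′ ++ g) ∎) ⟩
      ∑[ h ∈ substitute (reconnectEnd V₁ V₂ v₂) g₁ ] ∑[ h′ ∈ substitute ρ h ]
      ∑[ g ∈ substitute (ρ ∘ map₁ inj₂) g₂ ] result (h′ ++ g)
        ≈⟨ ∑-substitute-∘ χ≈ρ g₁ _ ⟩
      ∑[ h ∈ substitute χ g₁ ] ∑[ g ∈ substitute (ρ ∘ map₁ inj₂) g₂ ] result (h ++ g) ∎
      where
      ρ = reconnectEnd U V₃ v₃ ∘ map₁ f
      root = f (newRoot V₁ V₂ v₂ v₁)

      result : OrMultigraph ∣ W ∣ → ⟦ W ⟧
      result g = gen (g ++ map (mapEdge inj₂) g₃ , newRoot U V₃ v₃ root)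

  -- The parallel axiom

  module _ (V₁ V₂ V₃ : FinSet) where

    -- The simultaneous insertion into both copies of ⋆, which both sides of the parallel
    -- axiom compute.  It is symmetric under exchanging the two copies, so one of the sides
    -- suffices.
    parallelEnd : ∣ V₂ ∣ → ∣ V₃ ∣ → End ∣ V₁ ⊔ˢ ⋆ ⊔ˢ ⋆ ∣ → List (End ∣ V₁ ⊔ˢ V₂ ⊔ˢ V₃ ∣)
    parallelEnd r₂ r₃ (inj₁ (inj₁ v)  , l)      = [ inj₁ (inj₁ v) , l ]
    parallelEnd r₂ r₃ (inj₁ (inj₂ tt) , source) = [ inj₂ r₃ , source ]
    parallelEnd r₂ r₃ (inj₁ (inj₂ tt) , target) = map (λ w → inj₂ w , target) (elements V₃)
    parallelEnd r₂ r₃ (inj₂ tt        , source) = [ inj₁ (inj₂ r₂) , source ]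
    parallelEnd r₂ r₃ (inj₂ tt        , target) =
      map (λ w → inj₁ (inj₂ w) , target) (elements V₂)

    parallelRoot : ∣ V₂ ∣ → ∣ V₃ ∣ → ∣ V₁ ⊔ˢ ⋆ ⊔ˢ ⋆ ∣ → ∣ V₁ ⊔ˢ V₂ ⊔ˢ V₃ ∣
    parallelRoot r₂ r₃ (inj₁ (inj₁ v))  = inj₁ (inj₁ v)
    parallelRoot r₂ r₃ (inj₁ (inj₂ tt)) = inj₂ r₃
    parallelRoot r₂ r₃ (inj₂ tt)        = inj₁ (inj₂ r₂)

    private
      W = V₁ ⊔ˢ V₂ ⊔ˢ V₃
      open ΣV W

    parallelGraft : Pointed ∣ V₁ ⊔ˢ ⋆ ⊔ˢ ⋆ ∣ → Pointed ∣ V₂ ∣ → Pointed ∣ V₃ ∣ → ⟦ W ⟧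
    parallelGraft (g₁ , v₁) (g₂ , v₂) (g₃ , v₃) =
      ∑[ h ∈ substitute (parallelEnd v₂ v₃) g₁ ]
      gen ((h ++ map (mapEdge (inj₁ ∘ inj₂)) g₂) ++ map (mapEdge inj₂) g₃ , parallelRoot v₂ v₃ v₁)

    compose-parallel : ∀ p q t →
      W ⊢ compose K (V₁ ⊔ˢ V₂) V₃
            (transport {V₁ ⊔ˢ ⋆ ⊔ˢ V₂} {V₁ ⊔ˢ V₂ ⊔ˢ ⋆} ⊎-swapʳ (graft (V₁ ⊔ˢ ⋆) V₂ p q)) (gen t)
        ≈ parallelGraft p q t
    compose-parallel (g₁ , v₁) (g₂ , v₂) (g₃ , v₃) = begin
      compose K (V₁ ⊔ˢ V₂) V₃
        (transport {V₁ ⊔ˢ ⋆ ⊔ˢ V₂} {V₁ ⊔ˢ V₂ ⊔ˢ ⋆} ⊎-swapʳ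
          (graft (V₁ ⊔ˢ ⋆) V₂ (g₁ , v₁) (g₂ , v₂))) (gen (g₃ , v₃))
        ≈⟨ compose-transport-graft {V₁ ⊔ˢ ⋆} {V₂} {V₁ ⊔ˢ V₂} {V₃} ⊎-swapʳ
             g₁ v₁ g₂ v₂ g₃ v₃ parallelEnd-∑ ⟩
      ∑[ h ∈ substitute (parallelEnd v₂ v₃) g₁ ] ∑[ g ∈ substitute (ρ ∘ map₁ inj₂) g₂ ]
      gen ((h ++ g) ++ map (mapEdge inj₂) g₃ , root)
        -- No vertex of `V₂` is a copy of `⋆`, so the second insertion leaves a single choice at
        -- every end of `g₂`.
        ≈⟨ ∑-cong (substitute (parallelEnd v₂ v₃) g₁) (λ h →
             ∑-substitute-pure {f = inj₁ ∘ inj₂} (λ _ k → ∑-singleton _ k) g₂ _) ⟩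
      ∑[ h ∈ substitute (parallelEnd v₂ v₃) g₁ ]
      gen ((h ++ map (mapEdge (inj₁ ∘ inj₂)) g₂) ++ map (mapEdge inj₂) g₃ , root)
        ≈⟨ ∑-cong (substitute (parallelEnd v₂ v₃) g₁) (λ h → gen-≡ W (cong (_ ,_) (root≡ v₁))) ⟩
      parallelGraft (g₁ , v₁) (g₂ , v₂) (g₃ , v₃) ∎
      where
      open SetoidReasoning (LeftModule.≈ᴹ-setoid (space W))
      ρ = reconnectEnd (V₁ ⊔ˢ V₂) V₃ v₃ ∘ map₁ (Inverse.to ⊎-swapʳ)
      root = newRoot (V₁ ⊔ˢ V₂) V₃ v₃ (Inverse.to ⊎-swapʳ (newRoot (V₁ ⊔ˢ ⋆) V₂ v₂ v₁))

      parallelEnd-∑ : ∀ α k → W ⊢ ∑ (parallelEnd v₂ v₃ α) k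
                                ≈ ∑[ β ∈ reconnectEnd (V₁ ⊔ˢ ⋆) V₂ v₂ α ] ∑ (ρ β) k
      parallelEnd-∑ (inj₁ (inj₁ v)  , l)      k = Free.≋-sym (LeftModule.+ᴹ-identityʳ (space W) _)
      parallelEnd-∑ (inj₁ (inj₂ tt) , source) k = Free.≋-sym (LeftModule.+ᴹ-identityʳ (space W) _)
      parallelEnd-∑ (inj₁ (inj₂ tt) , target) k = Free.≋-sym (LeftModule.+ᴹ-identityʳ (space W) _)
      parallelEnd-∑ (inj₂ tt        , source) k = Free.≋-sym (LeftModule.+ᴹ-identityʳ (space W) _)
      parallelEnd-∑ (inj₂ tt        , target) k = begin
        ∑ (map (λ w → inj₁ (inj₂ w) , target) (elements V₂)) k  ≈⟨ ∑-map _ (elements V₂) k ⟩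
        ∑[ w ∈ elements V₂ ] k (inj₁ (inj₂ w) , target)
          ≈⟨ ∑-cong (elements V₂) (λ w → ∑-singleton _ k) ⟨
        ∑[ w ∈ elements V₂ ] ∑ (ρ (inj₂ w , target)) k          ≈⟨ ∑-map _ (elements V₂) _ ⟨
        ∑[ β ∈ map (λ w → inj₂ w , target) (elements V₂) ] ∑ (ρ β) k ∎

      root≡ : ∀ v → newRoot (V₁ ⊔ˢ V₂) V₃ v₃
                      (Inverse.to ⊎-swapʳ (newRoot (V₁ ⊔ˢ ⋆) V₂ v₂ v)) ≡ parallelRoot v₂ v₃ v
      root≡ (inj₁ (inj₁ v))  = refl
      root≡ (inj₁ (inj₂ tt)) = refl
      root≡ (inj₂ tt)        = refl

  module _ (V₁ V₂ V₃ : FinSet) where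

    private
      W = V₁ ⊔ˢ V₂ ⊔ˢ V₃
      W′ = V₁ ⊔ˢ V₃ ⊔ˢ V₂
      swap : {A B C : Set} → (A ⊎ B) ⊎ C → (A ⊎ C) ⊎ B
      swap = Inverse.to ⊎-swapʳ
      open ΣV W
      open SetoidReasoning (LeftModule.≈ᴹ-setoid (space W))

    parallelGraft-comm : ∀ p q t →
      W ⊢ transport {W′} {W} ⊎-swapʳ (parallelGraft V₁ V₃ V₂ (relabel swap p) t q)
        ≈ parallelGraft V₁ V₂ V₃ p q t
    parallelGraft-comm (g₁ , v₁) (g₂ , v₂) (g₃ , v₃) = begin
      transport {W′} {W} ⊎-swapʳ
        (parallelGraft V₁ V₃ V₂ (relabel swap (g₁ , v₁)) (g₃ , v₃) (g₂ , v₂))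
        ≈⟨ LinearMaps.∑-linear (space W′) (space W) (transport-linear {W′} {W} ⊎-swapʳ)
             (substitute ψ (map (mapEdge swap) g₁)) _ ⟩
      ∑[ h ∈ substitute ψ (map (mapEdge swap) g₁) ]
      gen (map (mapEdge swap) ((h ++ map (mapEdge (inj₁ ∘ inj₂)) g₃) ++ map (mapEdge inj₂) g₂)
          , swap (parallelRoot V₁ V₃ V₂ v₃ v₂ (swap v₁)))
        ≈⟨ ∑-≡ _ (substitute-map swap ψ g₁) ⟩
      ∑[ h ∈ substitute (ψ ∘ map₁ swap) g₁ ]
      gen (map (mapEdge swap) ((h ++ map (mapEdge (inj₁ ∘ inj₂)) g₃) ++ map (mapEdge inj₂) g₂)
          , swap (parallelRoot V₁ V₃ V₂ v₃ v₂ (swap v₁)))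
        -- The edges of `g₂` and `g₃` are appended in opposite orders on the two sides, so the
        -- graphs agree only up to permutation.
        ≈⟨ ∑-cong (substitute (ψ ∘ map₁ swap) g₁) (λ h → Free.gen-cong (graph↭ h , root≡ v₁)) ⟩
      ∑[ h ∈ substitute (ψ ∘ map₁ swap) g₁ ]
      gen ((map (mapEdge swap) h ++ map (mapEdge (inj₁ ∘ inj₂)) g₂) ++ map (mapEdge inj₂) g₃
          , parallelRoot V₁ V₂ V₃ v₂ v₃ v₁)
        ≈⟨ ∑-substitute-mapEdge swap parallelEnd-swap g₁ _ ⟩
      parallelGraft V₁ V₂ V₃ (g₁ , v₁) (g₂ , v₂) (g₃ , v₃) ∎
      where
      ψ = parallelEnd V₁ V₃ V₂ v₃ v₂

      parallelEnd-swap : ∀ α k → W ⊢ ∑ (parallelEnd V₁ V₂ V₃ v₂ v₃ α) k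
                                   ≈ ∑ (ψ (map₁ swap α)) (k ∘ map₁ swap)
      parallelEnd-swap (inj₁ (inj₁ v)  , l)      k = Free.≋-refl
      parallelEnd-swap (inj₁ (inj₂ tt) , source) k = Free.≋-refl
      parallelEnd-swap (inj₁ (inj₂ tt) , target) k =
        Free.≋-trans (∑-map _ (elements V₃) k) (Free.≋-sym (∑-map _ (elements V₃) _))
      parallelEnd-swap (inj₂ tt        , source) k = Free.≋-refl
      parallelEnd-swap (inj₂ tt        , target) k =
        Free.≋-trans (∑-map _ (elements V₂) k) (Free.≋-sym (∑-map _ (elements V₂) _))

      root≡ : ∀ v → swap (parallelRoot V₁ V₃ V₂ v₃ v₂ (swap v)) ≡ parallelRoot V₁ V₂ V₃ v₂ v₃ v
      root≡ (inj₁ (inj₁ v))  = refl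
      root≡ (inj₁ (inj₂ tt)) = refl
      root≡ (inj₂ tt)        = refl

      graph↭ : ∀ h → Permutation._↭_ (edgeSetoid ∣ W ∣)
        (map (mapEdge swap) ((h ++ map (mapEdge (inj₁ ∘ inj₂)) g₃) ++ map (mapEdge inj₂) g₂))
        ((map (mapEdge swap) h ++ map (mapEdge (inj₁ ∘ inj₂)) g₂) ++ map (mapEdge inj₂) g₃)
      graph↭ h = ↭-trans
        (↭-reflexive (≡.trans
          (map-mapEdge-++ {B = ∣ W′ ∣} swap inj₂ (h ++ map (mapEdge (inj₁ ∘ inj₂)) g₃) g₂)
          (cong (_++ _) (map-mapEdge-++ swap (inj₁ ∘ inj₂) h g₃))))
        (++-swapʳ (map (mapEdge swap) h) (map (mapEdge inj₂) g₃) (map (mapEdge (inj₁ ∘ inj₂)) g₂))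
        where
        open Permutation (edgeSetoid ∣ W ∣) using (_↭_; ↭-trans; ↭-reflexive)
        open Permutationₚ (edgeSetoid ∣ W ∣) using (++-comm; ++⁺ˡ)

        ++-swapʳ : ∀ xs ys zs → (xs ++ ys) ++ zs ↭ (xs ++ zs) ++ ys
        ++-swapʳ xs ys zs = ↭-trans (↭-reflexive (++-assoc xs ys zs))
          (↭-trans (++⁺ˡ xs (++-comm ys zs)) (↭-reflexive (≡.sym (++-assoc xs zs ys))))

  -- The sequential axiom

  module _ (V₁ V₂ V₃ : FinSet) where

    private
      W = V₁ ⊔ˢ V₂ ⊔ˢ V₃
      W′ = V₁ ⊔ˢ (V₂ ⊔ˢ V₃)
      assocˡ : {A B C : Set} → A ⊎ (B ⊎ C) → (A ⊎ B) ⊎ C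
      assocˡ = Inverse.to ⊎-assocˡ
      open ΣV W
      open SetoidReasoning (LeftModule.≈ᴹ-setoid (space W))

    compose-sequential : ∀ p q t →
      W ⊢ compose K (V₁ ⊔ˢ V₂) V₃
            (transport {V₁ ⊔ˢ (V₂ ⊔ˢ ⋆)} {V₁ ⊔ˢ V₂ ⊔ˢ ⋆} ⊎-assocˡ (graft V₁ (V₂ ⊔ˢ ⋆) p q)) (gen t)
        ≈ transport {W′} {W} ⊎-assocˡ (compose K V₁ (V₂ ⊔ˢ V₃) (gen p) (graft V₂ V₃ q t))
    compose-sequential (g₁ , v₁) (g₂ , v₂) (g₃ , v₃) = begin
      compose K (V₁ ⊔ˢ V₂) V₃
        (transport {V₁ ⊔ˢ (V₂ ⊔ˢ ⋆)} {V₁ ⊔ˢ V₂ ⊔ˢ ⋆} ⊎-assocˡ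
          (graft V₁ (V₂ ⊔ˢ ⋆) (g₁ , v₁) (g₂ , v₂))) (gen (g₃ , v₃))
        ≈⟨ compose-transport-graft {V₁} {V₂ ⊔ˢ ⋆} {V₁ ⊔ˢ V₂} {V₃} ⊎-assocˡ
             g₁ v₁ g₂ v₂ g₃ v₃ χ-∑ ⟩
      ∑[ h ∈ substitute χ g₁ ] ∑[ g ∈ substitute (ρ ∘ map₁ inj₂) g₂ ]
      gen ((h ++ g) ++ map (mapEdge inj₂) g₃ , root)
        ≈⟨ ∑-substitute-mapEdge assocˡ (λ α k → ∑-map _ (φ₁ α) k) g₁ _ ⟨
      ∑[ h ∈ substitute φ₁ g₁ ] ∑[ g ∈ substitute (ρ ∘ map₁ inj₂) g₂ ]
      gen ((map (mapEdge assocˡ) h ++ g) ++ map (mapEdge inj₂) g₃ , root)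
        ≈⟨ ∑-cong (substitute φ₁ g₁) (λ h →
             ∑-substitute-mapEdge (assocˡ ∘ inj₂) ρ-∑ g₂ _) ⟨
      ∑[ h ∈ substitute φ₁ g₁ ] ∑[ g ∈ substitute φ₂ g₂ ]
      gen ((map (mapEdge assocˡ) h ++ map (mapEdge (assocˡ ∘ inj₂)) g) ++ map (mapEdge inj₂) g₃
          , root)
        ≈⟨ ∑-cong (substitute φ₁ g₁) (λ h →
           ∑-cong (substitute φ₂ g₂) (λ g →
             gen-≡ W (cong₂ _,_ (graph≡ h g) (root≡ v₁ v₂)))) ⟩
      ∑[ h ∈ substitute φ₁ g₁ ] ∑[ g ∈ substitute φ₂ g₂ ]
      gen (relabel assocˡ
        (h ++ map (mapEdge inj₂) (g ++ map (mapEdge inj₂) g₃) , newRoot V₁ (V₂ ⊔ˢ V₃) r v₁))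
        -- All terms of the inner composite share the root `r`. The choices at the ends of `g₁`
        -- depend on the inserted graph only through this root, so they are independent of `g`.
        ≈⟨ ∑-swap (substitute φ₁ g₁) (substitute φ₂ g₂) _ ⟩
      ∑[ g ∈ substitute φ₂ g₂ ] ∑[ h ∈ substitute φ₁ g₁ ]
      gen (relabel assocˡ
        (h ++ map (mapEdge inj₂) (g ++ map (mapEdge inj₂) g₃) , newRoot V₁ (V₂ ⊔ˢ V₃) r v₁))
        ≈⟨ ∑-cong (substitute φ₂ g₂) (λ g →
             linear-graft V₁ (V₂ ⊔ˢ V₃) W (transport-linear {W′} {W} ⊎-assocˡ)
               g₁ v₁ (g ++ map (mapEdge inj₂) g₃) r) ⟨
      ∑[ g ∈ substitute φ₂ g₂ ]
      transport {W′} {W} ⊎-assocˡ (graft V₁ (V₂ ⊔ˢ V₃) (g₁ , v₁) (g ++ map (mapEdge inj₂) g₃ , r))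
        ≈⟨ linear-graft V₂ V₃ W
             (∘-linear {V₂ ⊔ˢ V₃} {W′} {W} (transport-linear {W′} {W} ⊎-assocˡ)
               (compose-linearʳ V₁ (V₂ ⊔ˢ V₃) (gen (g₁ , v₁)))) g₂ v₂ g₃ v₃ ⟨
      transport {W′} {W} ⊎-assocˡ
        (compose K V₁ (V₂ ⊔ˢ V₃) (gen (g₁ , v₁)) (graft V₂ V₃ (g₂ , v₂) (g₃ , v₃))) ∎
      where
      r = newRoot V₂ V₃ v₃ v₂
      root = newRoot (V₁ ⊔ˢ V₂) V₃ v₃ (assocˡ (newRoot V₁ (V₂ ⊔ˢ ⋆) v₂ v₁))
      ρ = reconnectEnd (V₁ ⊔ˢ V₂) V₃ v₃ ∘ map₁ assocˡ
      φ₁ = reconnectEnd V₁ (V₂ ⊔ˢ V₃) r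
      φ₂ = reconnectEnd V₂ V₃ v₃
      -- Read off from the right side: one insertion of `V₂ ⊔ˢ V₃`, then rebracketing. `χ-∑` shows
      -- that the two insertions of the left side amount to the same.
      χ = map (map₁ assocˡ) ∘ φ₁

      ρ-∑ : ∀ α k → W ⊢ ∑ (ρ (map₁ inj₂ α)) k
                      ≈ ∑ (reconnectEnd V₂ V₃ v₃ α) (k ∘ map₁ (assocˡ ∘ inj₂))
      ρ-∑ (inj₁ v  , l)      k = Free.≋-refl
      ρ-∑ (inj₂ tt , source) k = Free.≋-refl
      ρ-∑ (inj₂ tt , target) k =
        Free.≋-trans (∑-map _ (elements V₃) k) (Free.≋-sym (∑-map _ (elements V₃) _))

      -- A loose source end goes to the root of the second graph. If that root is the inner `⋆`, the
      -- end becomes loose again and moves on to `v₃`, in agreement with `newRoot`.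
      χ-source-∑ : ∀ v k → W ⊢ ∑ [ map₁ assocˡ (inj₂ (newRoot V₂ V₃ v₃ v) , source) ] k
                             ≈ ∑ [ inj₂ v , source ] (λ β → ∑ (ρ β) k)
      χ-source-∑ (inj₁ v)  k = Free.≋-sym (LeftModule.+ᴹ-identityʳ (space W) _)
      χ-source-∑ (inj₂ tt) k = Free.≋-sym (LeftModule.+ᴹ-identityʳ (space W) _)

      χ-∑ : ∀ α k → W ⊢ ∑ (χ α) k ≈ ∑[ β ∈ reconnectEnd V₁ (V₂ ⊔ˢ ⋆) v₂ α ] ∑ (ρ β) k
      χ-∑ (inj₁ v  , l)      k = Free.≋-sym (LeftModule.+ᴹ-identityʳ (space W) _)
      χ-∑ (inj₂ tt , source) k = χ-source-∑ v₂ k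
      χ-∑ (inj₂ tt , target) k = begin
        ∑ (map (map₁ assocˡ) (map (λ w → inj₂ w , target) (elements (V₂ ⊔ˢ V₃)))) k
          ≈⟨ Free.≋-trans
               (∑-map (map₁ assocˡ) (map (λ w → inj₂ w , target) (elements (V₂ ⊔ˢ V₃))) k)
               (∑-map (λ w → inj₂ w , target) (elements (V₂ ⊔ˢ V₃)) _) ⟩
        ∑[ w ∈ elements (V₂ ⊔ˢ V₃) ] k (assocˡ (inj₂ w) , target)
          ≈⟨ ∑-elements-⊔ V₂ V₃ _ ⟩
        ∑ (elements V₂) (λ w → k (inj₁ (inj₂ w) , target)) Free.⊕
        ∑ (elements V₃) (λ w → k (inj₂ w , target))
          ≈⟨ Free.⊕-cong (∑-cong (elements V₂) (λ w → ∑-singleton _ k))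
               (Free.≋-trans (∑-singleton tt _) (∑-map _ (elements V₃) k)) ⟨
        ∑ (elements V₂) (λ w → ∑ (ρ (inj₂ (inj₁ w) , target)) k) Free.⊕
        ∑ (elements ⋆) (λ w → ∑ (ρ (inj₂ (inj₂ w) , target)) k)
          ≈⟨ ∑-elements-⊔ V₂ ⋆ _ ⟨
        ∑[ w ∈ elements (V₂ ⊔ˢ ⋆) ] ∑ (ρ (inj₂ w , target)) k
          ≈⟨ ∑-map (λ w → inj₂ w , target) (elements (V₂ ⊔ˢ ⋆)) _ ⟨
        ∑[ β ∈ map (λ w → inj₂ w , target) (elements (V₂ ⊔ˢ ⋆)) ] ∑ (ρ β) k ∎

      root≡ : ∀ v v′ → newRoot (V₁ ⊔ˢ V₂) V₃ v₃ (assocˡ (newRoot V₁ (V₂ ⊔ˢ ⋆) v′ v))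
                       ≡ assocˡ (newRoot V₁ (V₂ ⊔ˢ V₃) (newRoot V₂ V₃ v₃ v′) v)
      root≡ (inj₁ v)  v′        = refl
      root≡ (inj₂ tt) (inj₁ v′) = refl
      root≡ (inj₂ tt) (inj₂ tt) = refl

      graph≡ : ∀ h g →
        (map (mapEdge assocˡ) h ++ map (mapEdge (assocˡ ∘ inj₂)) g) ++ map (mapEdge inj₂) g₃
        ≡ map (mapEdge assocˡ) (h ++ map (mapEdge inj₂) (g ++ map (mapEdge inj₂) g₃))
      graph≡ h g = ≡.sym (≡.trans
        (map-mapEdge-++ assocˡ inj₂ h (g ++ map (mapEdge inj₂) g₃))
        (≡.trans
          (cong (map (mapEdge assocˡ) h ++_) (map-mapEdge-++ (assocˡ ∘ inj₂) inj₂ g g₃))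
          (≡.sym (++-assoc (map (mapEdge assocˡ) h) _ _))))

  -- Naturality

  module _ {V₁ V₂ W₁ W₂ : FinSet} (σ₁ : V₁ ≅ W₁) (σ₂ : V₂ ≅ W₂) where

    private
      V = V₁ ⊔ˢ V₂
      W = W₁ ⊔ˢ W₂
      f₁ = Inverse.to (σ₁ ⊎-↔ ↔-id ⊤)
      f₂ = Inverse.to σ₂
      f = Inverse.to (σ₁ ⊎-↔ σ₂)
      open ΣV W
      open SetoidReasoning (LeftModule.≈ᴹ-setoid (space W))

    graft-natural : ∀ p q →
      W ⊢ graft W₁ W₂ (relabel f₁ p) (relabel f₂ q)
        ≈ transport {V} {W} (σ₁ ⊎-↔ σ₂) (graft V₁ V₂ p q)
    graft-natural (g₁ , v₁) (g₂ , v₂) = begin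
      graft W₁ W₂ (relabel f₁ (g₁ , v₁)) (relabel f₂ (g₂ , v₂))
        ≈⟨ graft-∑ W₁ W₂ (map (mapEdge f₁) g₁) (f₁ v₁) (map (mapEdge f₂) g₂) (f₂ v₂) ⟩
      ∑[ h ∈ substitute φ (map (mapEdge f₁) g₁) ] result h
        ≈⟨ ∑-≡ result (substitute-map f₁ φ g₁) ⟩
      ∑[ h ∈ substitute (φ ∘ map₁ f₁) g₁ ] result h
        ≈⟨ ∑-substitute-mapEdge f φ-∑ g₁ result ⟨
      ∑[ h ∈ substitute (reconnectEnd V₁ V₂ v₂) g₁ ] result (map (mapEdge f) h)
        ≈⟨ ∑-cong (substitute (reconnectEnd V₁ V₂ v₂) g₁) (λ h →
             gen-≡ W (cong₂ _,_ (graph≡ h) (root≡ v₁))) ⟩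
      ∑[ h ∈ substitute (reconnectEnd V₁ V₂ v₂) g₁ ]
      gen (relabel f (h ++ map (mapEdge inj₂) g₂ , newRoot V₁ V₂ v₂ v₁))
        ≈⟨ linear-graft V₁ V₂ W (transport-linear {V} {W} (σ₁ ⊎-↔ σ₂)) g₁ v₁ g₂ v₂ ⟨
      transport {V} {W} (σ₁ ⊎-↔ σ₂) (graft V₁ V₂ (g₁ , v₁) (g₂ , v₂)) ∎
      where
      φ = reconnectEnd W₁ W₂ (f₂ v₂)

      result : OrMultigraph ∣ W ∣ → ⟦ W ⟧
      result h = gen (h ++ map (mapEdge inj₂) (map (mapEdge f₂) g₂) , newRoot W₁ W₂ (f₂ v₂) (f₁ v₁))

      φ-∑ : ∀ α k → W ⊢ ∑ (φ (map₁ f₁ α)) k ≈ ∑ (reconnectEnd V₁ V₂ v₂ α) (k ∘ map₁ f)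
      φ-∑ (inj₁ v  , l)      k = Free.≋-refl
      φ-∑ (inj₂ tt , source) k = Free.≋-refl
      φ-∑ (inj₂ tt , target) k = begin
        ∑ (map (λ w → inj₂ w , target) (elements W₂)) k  ≈⟨ ∑-map _ (elements W₂) k ⟩
        -- The bijectivity of `σ₂` enters here: the vertices available to a loose target end are
        -- reindexed along it.
        ∑[ w ∈ elements W₂ ] k (inj₂ w , target)         ≈⟨ ∑-elements-≅ {V₂} {W₂} σ₂ _ ⟩
        ∑[ v ∈ elements V₂ ] k (inj₂ (f₂ v) , target)    ≈⟨ ∑-map _ (elements V₂) _ ⟨
        ∑ (map (λ w → inj₂ w , target) (elements V₂)) (k ∘ map₁ f) ∎

      root≡ : ∀ v → newRoot W₁ W₂ (f₂ v₂) (f₁ v) ≡ f (newRoot V₁ V₂ v₂ v)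
      root≡ (inj₁ v)  = refl
      root≡ (inj₂ tt) = refl

      graph≡ : ∀ h → map (mapEdge f) h ++ map (mapEdge inj₂) (map (mapEdge f₂) g₂)
                     ≡ map (mapEdge f) (h ++ map (mapEdge inj₂) g₂)
      graph≡ h = ≡.trans (cong (map (mapEdge f) h ++_) (≡.sym (map-∘ g₂)))
        (≡.sym (map-mapEdge-++ f inj₂ h g₂))

  -- The unit axioms

  module _ (V W : FinSet) (w : ∣ W ∣) (w-only : IsSingleton W w) where

    private
      f = Inverse.to (↔-id ∣ V ∣ ⊎-↔ ⊤↔singleton W w w-only)
      open ΣV (V ⊔ˢ W)
      open SetoidReasoning (LeftModule.≈ᴹ-setoid (space (V ⊔ˢ W)))

    graft-identityʳ : ∀ p → V ⊔ˢ W ⊢ graft V W p ([] , w) ≈ gen (relabel f p)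
    graft-identityʳ (g , v) = begin
      graft V W (g , v) ([] , w)
        ≈⟨ graft-∑ V W g v [] w ⟩
      ∑[ h ∈ substitute (reconnectEnd V W w) g ] gen (h ++ [] , newRoot V W w v)
        ≈⟨ ∑-substitute-pure reconnectEnd-∑ g _ ⟩
      gen (map (mapEdge f) g ++ [] , newRoot V W w v)
        ≈⟨ gen-≡ (V ⊔ˢ W) (cong₂ _,_ (++-identityʳ (map (mapEdge f) g)) (root≡ v)) ⟩
      gen (relabel f (g , v)) ∎
      where
      reconnectEnd-∑ : ∀ α k → V ⊔ˢ W ⊢ ∑ (reconnectEnd V W w α) k ≈ k (map₁ f α)
      reconnectEnd-∑ (inj₁ v  , l)      k = ∑-singleton _ k
      reconnectEnd-∑ (inj₂ tt , source) k = ∑-singleton _ k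
      reconnectEnd-∑ (inj₂ tt , target) k = begin
        ∑ (map (λ u → inj₂ u , target) (elements W)) k  ≈⟨ ∑-map _ (elements W) k ⟩
        ∑[ u ∈ elements W ] k (inj₂ u , target)
          -- `elements W` does not reduce for an abstract one-point set, so the sum is carried over
          -- to `⋆`, whose list of elements computes.
          ≈⟨ ∑-elements-≅ {⋆} {W} (⊤↔singleton W w w-only) _ ⟩
        ∑[ u ∈ elements ⋆ ] k (inj₂ w , target)         ≈⟨ ∑-singleton tt _ ⟩
        k (inj₂ w , target)                             ∎

      root≡ : ∀ v → newRoot V W w v ≡ f v
      root≡ (inj₁ v)  = refl
      root≡ (inj₂ tt) = refl

  -- An edgeless graph has no loose ends, so the sum reduces to one term plus zero. The root of the
  -- unit is `⋆` itself, so the root of `p` survives.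
  graft-identityˡ : ∀ V p →
    V ⊢ transport {∅ ⊔ˢ V} {V} ⊥-⊎ (graft ∅ V ([] , inj₂ tt) p) ≈ gen p
  graft-identityˡ V (g , v) = Free.≋-trans (LeftModule.+ᴹ-identityʳ (space V) _)
    (gen-≡ V (cong (_, v) (≡.trans
      (≡.sym (map-∘ {g = mapEdge (Inverse.to ⊥-⊎)} {f = mapEdge inj₂} g)) (map-id g))))

-- Extending the axioms from basis elements by multilinearity

theorem2p1 : ∀ {c ℓ₁ ℓ₂} (K : HeytingField c ℓ₁ ℓ₂) → CharacteristicZero K →
    IsOperad K (MG•or K) (unit K) (λ {V₁} {V₂} → compose K V₁ V₂)
theorem2p1 K _ = record
  -- The empty set offers no vertex to serve as root, so the basis is empty and the identity agrees
  -- with the zero map.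
  { empty-zero   = Free.linear-ext K _ (space ∅) (id-linear ∅)
      (LinearMaps.0-linear (space ∅) (space ∅)) (λ { (_ , ()) })
  ; e-natural    = λ _ _ _ _ → Free.≋-refl
  ; ∘-linearˡ    = λ {V₁} {V₂} → compose-linearˡ V₁ V₂
  ; ∘-linearʳ    = λ {V₁} {V₂} → compose-linearʳ V₁ V₂
  ; ∘-natural    = λ {V₁} {V₂} {W₁} {W₂} σ₁ σ₂ x y →
      Free.linear-ext K _ (space (W₁ ⊔ˢ W₂))
        (∘-linear {V₁ ⊔ˢ ⋆} {W₁ ⊔ˢ ⋆} {W₁ ⊔ˢ W₂}
          (compose-linearˡ W₁ W₂ (transport {V₂} {W₂} σ₂ y))
          (transport-linear {V₁ ⊔ˢ ⋆} {W₁ ⊔ˢ ⋆} (σ₁ ⊎-↔ ↔-id ⊤)))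
        (∘-linear {V₁ ⊔ˢ ⋆} {V₁ ⊔ˢ V₂} {W₁ ⊔ˢ W₂}
          (transport-linear {V₁ ⊔ˢ V₂} {W₁ ⊔ˢ W₂} (σ₁ ⊎-↔ σ₂)) (compose-linearˡ V₁ V₂ y))
        (λ p → Free.linear-ext K _ (space (W₁ ⊔ˢ W₂))
          (∘-linear {V₂} {W₂} {W₁ ⊔ˢ W₂}
            (compose-linearʳ W₁ W₂ (gen (relabel (Inverse.to (σ₁ ⊎-↔ ↔-id ⊤)) p)))
            (transport-linear {V₂} {W₂} σ₂))
          (∘-linear {V₂} {V₁ ⊔ˢ V₂} {W₁ ⊔ˢ W₂}
            (transport-linear {V₁ ⊔ˢ V₂} {W₁ ⊔ˢ W₂} (σ₁ ⊎-↔ σ₂)) (compose-linearʳ V₁ V₂ (gen p)))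
          (graft-natural σ₁ σ₂ p) y) x
  ; ∘-parallel   = λ {V₁} {V₂} {V₃} x y z →
      let
        W  = V₁ ⊔ˢ V₂ ⊔ˢ V₃
        W′ = V₁ ⊔ˢ V₃ ⊔ˢ V₂
        swap₂ = transport-linear {V₁ ⊔ˢ ⋆ ⊔ˢ V₂} {V₁ ⊔ˢ V₂ ⊔ˢ ⋆} ⊎-swapʳ
        swap₃ = transport-linear {V₁ ⊔ˢ ⋆ ⊔ˢ V₃} {V₁ ⊔ˢ V₃ ⊔ˢ ⋆} ⊎-swapʳ
        swap⋆ = transport-linear {V₁ ⊔ˢ ⋆ ⊔ˢ ⋆} {V₁ ⊔ˢ ⋆ ⊔ˢ ⋆} ⊎-swapʳ
        swap  = transport-linear {W′} {W} ⊎-swapʳ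
      in
      -- The arguments are specialised to generators in the order `x`, `y`, `z`. `compose` recurses
      -- on its left argument first, so after `x` and `y` the inner composite on the left side
      -- reduces to `graft`.
      Free.linear-ext K _ (space W)
        (∘-linear {V₁ ⊔ˢ ⋆ ⊔ˢ ⋆} {V₁ ⊔ˢ V₂ ⊔ˢ ⋆} {W} (compose-linearˡ (V₁ ⊔ˢ V₂) V₃ z)
          (∘-linear {V₁ ⊔ˢ ⋆ ⊔ˢ ⋆} {V₁ ⊔ˢ ⋆ ⊔ˢ V₂} {V₁ ⊔ˢ V₂ ⊔ˢ ⋆} swap₂
            (compose-linearˡ (V₁ ⊔ˢ ⋆) V₂ y)))
        (∘-linear {V₁ ⊔ˢ ⋆ ⊔ˢ ⋆} {W′} {W} swap
          (∘-linear {V₁ ⊔ˢ ⋆ ⊔ˢ ⋆} {V₁ ⊔ˢ V₃ ⊔ˢ ⋆} {W′} (compose-linearˡ (V₁ ⊔ˢ V₃) V₂ y)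
            (∘-linear {V₁ ⊔ˢ ⋆ ⊔ˢ ⋆} {V₁ ⊔ˢ ⋆ ⊔ˢ V₃} {V₁ ⊔ˢ V₃ ⊔ˢ ⋆} swap₃
              (∘-linear {V₁ ⊔ˢ ⋆ ⊔ˢ ⋆} {V₁ ⊔ˢ ⋆ ⊔ˢ ⋆} {V₁ ⊔ˢ ⋆ ⊔ˢ V₃}
                (compose-linearˡ (V₁ ⊔ˢ ⋆) V₃ z) swap⋆))))
        (λ p → Free.linear-ext K _ (space W)
          (∘-linear {V₂} {V₁ ⊔ˢ V₂ ⊔ˢ ⋆} {W} (compose-linearˡ (V₁ ⊔ˢ V₂) V₃ z)
            (∘-linear {V₂} {V₁ ⊔ˢ ⋆ ⊔ˢ V₂} {V₁ ⊔ˢ V₂ ⊔ˢ ⋆} swap₂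
              (compose-linearʳ (V₁ ⊔ˢ ⋆) V₂ (gen p))))
          (∘-linear {V₂} {W′} {W} swap (compose-linearʳ (V₁ ⊔ˢ V₃) V₂
            (transport {V₁ ⊔ˢ ⋆ ⊔ˢ V₃} {V₁ ⊔ˢ V₃ ⊔ˢ ⋆} ⊎-swapʳ
              (compose K (V₁ ⊔ˢ ⋆) V₃ (gen (relabel (Inverse.to ⊎-swapʳ) p)) z))))
          (λ q → Free.linear-ext K _ (space W)
            (compose-linearʳ (V₁ ⊔ˢ V₂) V₃
              (transport {V₁ ⊔ˢ ⋆ ⊔ˢ V₂} {V₁ ⊔ˢ V₂ ⊔ˢ ⋆} ⊎-swapʳ (graft (V₁ ⊔ˢ ⋆) V₂ p q)))
            (∘-linear {V₃} {W′} {W} swap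
              (∘-linear {V₃} {V₁ ⊔ˢ V₃ ⊔ˢ ⋆} {W′} (compose-linearˡ (V₁ ⊔ˢ V₃) V₂ (gen q))
                (∘-linear {V₃} {V₁ ⊔ˢ ⋆ ⊔ˢ V₃} {V₁ ⊔ˢ V₃ ⊔ˢ ⋆} swap₃
                  (compose-linearʳ (V₁ ⊔ˢ ⋆) V₃ (gen (relabel (Inverse.to ⊎-swapʳ) p))))))
            -- The right side is a left side with `q` and `t`, and the two copies of `⋆`, exchanged,
            -- so the same evaluation applies to it.
            (λ t → Free.≋-trans (compose-parallel V₁ V₂ V₃ p q t)
              (Free.≋-sym (Free.≋-trans
                (⟦⟧-cong swap
                  (compose-parallel V₁ V₃ V₂ (relabel (Inverse.to ⊎-swapʳ) p) t q))
                (parallelGraft-comm V₁ V₂ V₃ p q t)))) z) y) x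
  ; ∘-sequential = λ {V₁} {V₂} {V₃} x y z →
      let
        W  = V₁ ⊔ˢ V₂ ⊔ˢ V₃
        W′ = V₁ ⊔ˢ (V₂ ⊔ˢ V₃)
        assoc⋆ = transport-linear {V₁ ⊔ˢ (V₂ ⊔ˢ ⋆)} {V₁ ⊔ˢ V₂ ⊔ˢ ⋆} ⊎-assocˡ
        assoc  = transport-linear {W′} {W} ⊎-assocˡ
      in
      Free.linear-ext K _ (space W)
        (∘-linear {V₁ ⊔ˢ ⋆} {V₁ ⊔ˢ V₂ ⊔ˢ ⋆} {W} (compose-linearˡ (V₁ ⊔ˢ V₂) V₃ z)
          (∘-linear {V₁ ⊔ˢ ⋆} {V₁ ⊔ˢ (V₂ ⊔ˢ ⋆)} {V₁ ⊔ˢ V₂ ⊔ˢ ⋆} assoc⋆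
            (compose-linearˡ V₁ (V₂ ⊔ˢ ⋆) y)))
        (∘-linear {V₁ ⊔ˢ ⋆} {W′} {W} assoc (compose-linearˡ V₁ (V₂ ⊔ˢ V₃) (compose K V₂ V₃ y z)))
        (λ p → Free.linear-ext K _ (space W)
          (∘-linear {V₂ ⊔ˢ ⋆} {V₁ ⊔ˢ V₂ ⊔ˢ ⋆} {W} (compose-linearˡ (V₁ ⊔ˢ V₂) V₃ z)
            (∘-linear {V₂ ⊔ˢ ⋆} {V₁ ⊔ˢ (V₂ ⊔ˢ ⋆)} {V₁ ⊔ˢ V₂ ⊔ˢ ⋆} assoc⋆
              (compose-linearʳ V₁ (V₂ ⊔ˢ ⋆) (gen p))))
          (∘-linear {V₂ ⊔ˢ ⋆} {W′} {W} assoc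
            (∘-linear {V₂ ⊔ˢ ⋆} {V₂ ⊔ˢ V₃} {W′} (compose-linearʳ V₁ (V₂ ⊔ˢ V₃) (gen p))
              (compose-linearˡ V₂ V₃ z)))
          (λ q → Free.linear-ext K _ (space W)
            (compose-linearʳ (V₁ ⊔ˢ V₂) V₃
              (transport {V₁ ⊔ˢ (V₂ ⊔ˢ ⋆)} {V₁ ⊔ˢ V₂ ⊔ˢ ⋆} ⊎-assocˡ (graft V₁ (V₂ ⊔ˢ ⋆) p q)))
            (∘-linear {V₃} {W′} {W} assoc
              (∘-linear {V₃} {V₂ ⊔ˢ V₃} {W′} (compose-linearʳ V₁ (V₂ ⊔ˢ V₃) (gen p))
                (compose-linearʳ V₂ V₃ (gen q))))
            (compose-sequential V₁ V₂ V₃ p q) z) y) x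
  ; ∘-identityʳ  = λ {V} {W} x w w-only → Free.linear-ext K _ (space (V ⊔ˢ W))
      (compose-linearˡ V W (unit K W w w-only))
      (transport-linear {V ⊔ˢ ⋆} {V ⊔ˢ W} (↔-id ∣ V ∣ ⊎-↔ ⊤↔singleton W w w-only))
      (graft-identityʳ V W w w-only) x
  ; ∘-identityˡ  = λ {V} → Free.linear-ext K _ (space V)
      (∘-linear {V} {∅ ⊔ˢ V} {V} (transport-linear {∅ ⊔ˢ V} {V} ⊥-⊎)
        (compose-linearʳ ∅ V (gen ([] , inj₂ tt))))
      (id-linear V) (graft-identityˡ V)
  }
  where
  open Grafting K
  open Species (MG•or K) using (space; transport; transport-linear)
  open LeftModuleMorphisms.IsLeftModuleHomomorphism using (⟦⟧-cong)
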